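{- Let $p,q$ be two distinct constants with $q<p$, and let $G\sim G(kn,k,p,q)$ be an unweighted random graph from the planted partition model with partition function $\Psi$. Let $H=H(V,E,w)$ be the auxiliary weighted graph derived from $G$ (same vertices and edges), in which each edge $(u,v)$ has weight $w(u,v)=t(u,v)$, the number of triangles of $G$ that contain the edge $(u,v)$. Consider random walks $X_t$ and $Y_t$ on the vertices of $G$ and $H$, respectively, where the walk on $G$ is the standard random walk (from $u$, move to a uniformly random neighbor of $u$), and the walk on $H$ moves from $u$ to a neighbor $v$ chosen with probability proportional to the edge weight $w(u,v)$. Then with probability $1-o(1)$ over the choice of $G$, for all vertices $u$, $$\Pr\big(\Psi(X_{t+1})=\Psi(X_t)\mid X_t=u\big)<\Pr\big(\Psi(Y_{t+1})=\Psi(Y_t)\mid Y_t=u\big).$$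
   Context: Planted partition model $G(kn,k,p,q)$: the vertex set $V$ has $kn$ vertices and is partitioned into $k$ clusters, each with exactly $n$ vertices. The partition function $\Psi:V\to[k]$ maps each vertex to its cluster. Each pair of distinct vertices $u,v$ is joined by an edge, independently, with probability $p$ if $\Psi(u)=\Psi(v)$ and with probability $q<p$ otherwise. The $o(1)$ is as $n\to\infty$. The probabilities in the displayed inequality are over one step of the walk, for the given graph $G$. If a vertex $u$ is in no triangle, the triangle-weighted walk (the walk on $H$) stays at $u$.
   Formalization: The formal theorem assumes at least two clusters (k ≥ 2) and q > 0; for k = 1 or q = 0 no edge leaves a cluster, both probabilities equal 1 at every vertex, and the strict inequality fails. -}

module Defs where

open import Algebra.Bundles using (module CommutativeMonoid)
open import Algebra.Definitions.RawMonoid using (sum)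
import Algebra.Properties.CommutativeSemigroup as CommutativeSemigroup
open import Data.Bool.Base using (Bool; true; false; _∧_; if_then_else_)
open import Data.Fin.Base using (Fin; zero; suc)
import Data.Fin.Properties as Fin
open import Data.Integer.Base using (+_)
open import Data.List.Base using (List; []; _∷_; _++_; map; foldr; filter; allFin; cartesianProductWith)
open import Data.Nat.Base as ℕ using (ℕ; zero; suc; _⊔_)
import Data.Nat.Properties as ℕ
open import Data.Product.Base using (_×_; _,_; ∃-syntax; map₂)
import Data.Product.Base as Product
open import Data.Rational.Base as ℚ using (ℚ; 0ℚ; 1ℚ; ½; _/_; ∣_∣)
import Data.Rational.Properties as ℚ
open import Data.Vec.Base using (Vec; []; _∷_; lookup)
open import Level using (0ℓ)
open import Relation.Binary.PropositionalEquality using (_≡_; refl; sym; trans; cong; cong₂; subst; module ≡-Reasoning)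
open import Relation.Nullary.Decidable using (does)
open import Relation.Unary using (Pred; Decidable)

-- Real numbers: Cauchy sequences of rationals, with pointwise operations.
-- Two sequences x, y represent the same real iff x ≤ᴿ y and y ≤ᴿ x.

Cauchy : (ℕ → ℚ) → Set
Cauchy x = ∀ ε → 0ℚ ℚ.< ε →
  ∃[ N ] (∀ m n → N ℕ.≤ m → N ℕ.≤ n → ∣ x m ℚ.- x n ∣ ℚ.< ε)

record ℝ : Set where
  constructor mkℝ
  field
    seq    : ℕ → ℚ
    cauchy : Cauchy seq

open ℝ public

infix 4 _<ᴿ_ _≤ᴿ_

_<ᴿ_ : ℝ → ℝ → Set
x <ᴿ y = ∃[ ε ] 0ℚ ℚ.< ε ×
  (∃[ N ] (∀ n → N ℕ.≤ n → seq x n ℚ.+ ε ℚ.≤ seq y n))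

_≤ᴿ_ : ℝ → ℝ → Set
x ≤ᴿ y = ∀ ε → 0ℚ ℚ.< ε →
  ∃[ N ] (∀ n → N ℕ.≤ n → seq x n ℚ.≤ seq y n ℚ.+ ε)

fromℚ : ℚ → ℝ
fromℚ a = mkℝ (λ _ → a) λ ε 0<ε →
  0 , λ _ _ _ _ → subst (λ z → ∣ z ∣ ℚ.< ε) (sym (ℚ.+-inverseʳ a)) 0<ε

0ᴿ 1ᴿ : ℝ
0ᴿ = fromℚ 0ℚ
1ᴿ = fromℚ 1ℚ

private

  open CommutativeSemigroup
    (CommutativeMonoid.commutativeSemigroup ℚ.+-0-commutativeMonoid) using (interchange)

  cancel : ∀ a b → a ≡ (a ℚ.- b) ℚ.+ b
  cancel a b = sym (trans (ℚ.+-assoc a (ℚ.- b) b)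
    (trans (cong (a ℚ.+_) (ℚ.+-inverseˡ b)) (ℚ.+-identityʳ a)))

  halve : ∀ ε → ½ ℚ.* ε ℚ.+ ½ ℚ.* ε ≡ ε
  halve ε = trans (sym (ℚ.*-distribʳ-+ ε ½ ½)) (ℚ.*-identityˡ ε)

  0<½* : ∀ ε → 0ℚ ℚ.< ε → 0ℚ ℚ.< ½ ℚ.* ε
  0<½* ε 0<ε = subst (ℚ._< ½ ℚ.* ε) (ℚ.*-zeroʳ ½) (ℚ.*-monoʳ-<-pos ½ 0<ε)

  cauchy-+ : ∀ x y → Cauchy x → Cauchy y → Cauchy (λ n → x n ℚ.+ y n)
  cauchy-+ x y cx cy ε 0<ε
    with cx (½ ℚ.* ε) (0<½* ε 0<ε) | cy (½ ℚ.* ε) (0<½* ε 0<ε)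
  ... | M , hx | N , hy = M ⊔ N , λ m n M⊔N≤m M⊔N≤n →
    let open ℚ.≤-Reasoning in begin-strict
      ∣ (x m ℚ.+ y m) ℚ.- (x n ℚ.+ y n) ∣       ≡⟨ cong ∣_∣ (rearrange (x m) (y m) (x n) (y n)) ⟩
      ∣ (x m ℚ.- x n) ℚ.+ (y m ℚ.- y n) ∣       ≤⟨ ℚ.∣p+q∣≤∣p∣+∣q∣ (x m ℚ.- x n) (y m ℚ.- y n) ⟩
      ∣ x m ℚ.- x n ∣ ℚ.+ ∣ y m ℚ.- y n ∣       <⟨ ℚ.+-mono-<
        (hx m n (ℕ.m⊔n≤o⇒m≤o M N M⊔N≤m) (ℕ.m⊔n≤o⇒m≤o M N M⊔N≤n))
        (hy m n (ℕ.m⊔n≤o⇒n≤o M N M⊔N≤m) (ℕ.m⊔n≤o⇒n≤o M N M⊔N≤n)) ⟩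
      ½ ℚ.* ε ℚ.+ ½ ℚ.* ε                       ≡⟨ halve ε ⟩
      ε                                         ∎
    where
    rearrange : ∀ a b c d → (a ℚ.+ b) ℚ.- (c ℚ.+ d) ≡ (a ℚ.- c) ℚ.+ (b ℚ.- d)
    rearrange a b c d = trans (cong ((a ℚ.+ b) ℚ.+_) (ℚ.neg-distrib-+ c d))
      (interchange a b (ℚ.- c) (ℚ.- d))

  cauchy-neg : ∀ x → Cauchy x → Cauchy (λ n → ℚ.- x n)
  cauchy-neg x cx ε 0<ε = map₂
    (λ h m n N≤m N≤n → subst (ℚ._< ε) (flip (x m) (x n)) (h m n N≤m N≤n)) (cx ε 0<ε)
    where
    flip : ∀ a b → ∣ a ℚ.- b ∣ ≡ ∣ (ℚ.- a) ℚ.- (ℚ.- b) ∣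
    flip a b = trans (sym (ℚ.∣-p∣≡∣p∣ (a ℚ.- b))) (cong ∣_∣ (ℚ.neg-distrib-+ a (ℚ.- b)))

  eventuallyBounded : ∀ x → Cauchy x →
    ∃[ B ] 0ℚ ℚ.< B × (∃[ N ] (∀ n → N ℕ.≤ n → ∣ x n ∣ ℚ.≤ B))
  eventuallyBounded x cx with cx 1ℚ (ℚ.positive⁻¹ 1ℚ)
  ... | N , h = 1ℚ ℚ.+ ∣ x N ∣ ,
    ℚ.<-≤-trans (ℚ.positive⁻¹ 1ℚ)
      (subst (ℚ._≤ 1ℚ ℚ.+ ∣ x N ∣) (ℚ.+-identityʳ 1ℚ) (ℚ.+-monoʳ-≤ 1ℚ (ℚ.0≤∣p∣ (x N)))) ,
    N , λ n N≤n → let open ℚ.≤-Reasoning in begin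
      ∣ x n ∣                       ≡⟨ cong ∣_∣ (cancel (x n) (x N)) ⟩
      ∣ (x n ℚ.- x N) ℚ.+ x N ∣     ≤⟨ ℚ.∣p+q∣≤∣p∣+∣q∣ (x n ℚ.- x N) (x N) ⟩
      ∣ x n ℚ.- x N ∣ ℚ.+ ∣ x N ∣   ≤⟨ ℚ.+-monoˡ-≤ ∣ x N ∣ (ℚ.<⇒≤ (h n N N≤n ℕ.≤-refl)) ⟩
      1ℚ ℚ.+ ∣ x N ∣                ∎

  shrink : ∀ B → 0ℚ ℚ.< B → ∀ ε → 0ℚ ℚ.< ε → ∃[ δ ] 0ℚ ℚ.< δ × B ℚ.* δ ≡ ε
  shrink B 0<B ε 0<ε = B⁻¹ ℚ.* ε ,
    subst (ℚ._< B⁻¹ ℚ.* ε) (ℚ.*-zeroʳ B⁻¹)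
      (ℚ.*-monoʳ-<-pos B⁻¹ {{ℚ.1/pos⇒pos B {{ℚ.positive 0<B}}}} 0<ε) ,
    trans (sym (ℚ.*-assoc B B⁻¹ ε))
      (trans (cong (ℚ._* ε) (ℚ.*-inverseʳ B {{B≢0}})) (ℚ.*-identityˡ ε))
    where
    B≢0 : ℚ.NonZero B
    B≢0 = ℚ.pos⇒nonZero B {{ℚ.positive 0<B}}
    B⁻¹ : ℚ
    B⁻¹ = (ℚ.1/ B) {{B≢0}}

  scale : ∀ B → 0ℚ ℚ.< B → ∀ z → Cauchy z → ∀ ε → 0ℚ ℚ.< ε →
    ∃[ N ] (∀ m n → N ℕ.≤ m → N ℕ.≤ n → B ℚ.* ∣ z m ℚ.- z n ∣ ℚ.< ε)
  scale B 0<B z cz ε 0<ε with shrink B 0<B ε 0<ε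
  ... | δ , 0<δ , Bδ≡ε = map₂
    (λ h m n N≤m N≤n → subst (_ ℚ.<_) Bδ≡ε
      (ℚ.*-monoʳ-<-pos B {{ℚ.positive 0<B}} (h m n N≤m N≤n)))
    (cz δ 0<δ)

  cauchy-* : ∀ x y → Cauchy x → Cauchy y → Cauchy (λ n → x n ℚ.* y n)
  cauchy-* x y cx cy ε 0<ε
    with eventuallyBounded x cx | eventuallyBounded y cy
  ... | A , 0<A , N₁ , x≤A | B , 0<B , N₂ , y≤B
    with scale A 0<A y cy (½ ℚ.* ε) (0<½* ε 0<ε) | scale B 0<B x cx (½ ℚ.* ε) (0<½* ε 0<ε)
  ... | N₃ , hy | N₄ , hx = (N₁ ⊔ N₂) ⊔ (N₃ ⊔ N₄) , λ m n N≤m N≤n →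
    let N₁₂≤m = ℕ.m⊔n≤o⇒m≤o (N₁ ⊔ N₂) (N₃ ⊔ N₄) N≤m
        N₃₄≤m = ℕ.m⊔n≤o⇒n≤o (N₁ ⊔ N₂) (N₃ ⊔ N₄) N≤m
        N₁₂≤n = ℕ.m⊔n≤o⇒m≤o (N₁ ⊔ N₂) (N₃ ⊔ N₄) N≤n
        N₃₄≤n = ℕ.m⊔n≤o⇒n≤o (N₁ ⊔ N₂) (N₃ ⊔ N₄) N≤n
        dx = ∣ x m ℚ.- x n ∣
        dy = ∣ y m ℚ.- y n ∣
        open ℚ.≤-Reasoning
    in begin-strict
      ∣ x m ℚ.* y m ℚ.- x n ℚ.* y n ∣
        ≡⟨ cong ∣_∣ (rearrange (x m) (y m) (x n) (y n)) ⟩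
      ∣ x m ℚ.* (y m ℚ.- y n) ℚ.+ y n ℚ.* (x m ℚ.- x n) ∣
        ≤⟨ ℚ.∣p+q∣≤∣p∣+∣q∣ (x m ℚ.* (y m ℚ.- y n)) (y n ℚ.* (x m ℚ.- x n)) ⟩
      ∣ x m ℚ.* (y m ℚ.- y n) ∣ ℚ.+ ∣ y n ℚ.* (x m ℚ.- x n) ∣
        ≡⟨ cong₂ ℚ._+_ (ℚ.∣p*q∣≡∣p∣*∣q∣ (x m) (y m ℚ.- y n)) (ℚ.∣p*q∣≡∣p∣*∣q∣ (y n) (x m ℚ.- x n)) ⟩
      ∣ x m ∣ ℚ.* dy ℚ.+ ∣ y n ∣ ℚ.* dx
        ≤⟨ ℚ.+-mono-≤
             (ℚ.*-monoʳ-≤-nonNeg dy {{ℚ.∣-∣-nonNeg (y m ℚ.- y n)}}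
               (x≤A m (ℕ.m⊔n≤o⇒m≤o N₁ N₂ N₁₂≤m)))
             (ℚ.*-monoʳ-≤-nonNeg dx {{ℚ.∣-∣-nonNeg (x m ℚ.- x n)}}
               (y≤B n (ℕ.m⊔n≤o⇒n≤o N₁ N₂ N₁₂≤n))) ⟩
      A ℚ.* dy ℚ.+ B ℚ.* dx
        <⟨ ℚ.+-mono-<
             (hy m n (ℕ.m⊔n≤o⇒m≤o N₃ N₄ N₃₄≤m) (ℕ.m⊔n≤o⇒m≤o N₃ N₄ N₃₄≤n))
             (hx m n (ℕ.m⊔n≤o⇒n≤o N₃ N₄ N₃₄≤m) (ℕ.m⊔n≤o⇒n≤o N₃ N₄ N₃₄≤n)) ⟩
      ½ ℚ.* ε ℚ.+ ½ ℚ.* ε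
        ≡⟨ halve ε ⟩
      ε ∎
    where
    rearrange : ∀ a b c d → a ℚ.* b ℚ.- c ℚ.* d ≡ a ℚ.* (b ℚ.- d) ℚ.+ d ℚ.* (a ℚ.- c)
    rearrange a b c d = begin
      a ℚ.* b ℚ.- c ℚ.* d
        ≡⟨ cong (ℚ._- c ℚ.* d) (cancel (a ℚ.* b) (a ℚ.* d)) ⟩
      ((a ℚ.* b ℚ.- a ℚ.* d) ℚ.+ a ℚ.* d) ℚ.- c ℚ.* d
        ≡⟨ ℚ.+-assoc (a ℚ.* b ℚ.- a ℚ.* d) (a ℚ.* d) (ℚ.- (c ℚ.* d)) ⟩
      (a ℚ.* b ℚ.- a ℚ.* d) ℚ.+ (a ℚ.* d ℚ.- c ℚ.* d)
        ≡⟨ cong₂ ℚ._+_ (*-distribˡ-- a b d)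
             (trans (cong₂ ℚ._-_ (ℚ.*-comm a d) (ℚ.*-comm c d)) (*-distribˡ-- d a c)) ⟩
      a ℚ.* (b ℚ.- d) ℚ.+ d ℚ.* (a ℚ.- c) ∎
      where
      open ≡-Reasoning
      *-distribˡ-- : ∀ u v w → u ℚ.* v ℚ.- u ℚ.* w ≡ u ℚ.* (v ℚ.- w)
      *-distribˡ-- u v w = sym (trans (ℚ.*-distribˡ-+ u v (ℚ.- w))
        (cong (u ℚ.* v ℚ.+_) (sym (ℚ.neg-distribʳ-* u w))))

infixl 6 _+ᴿ_ _-ᴿ_
infixl 7 _*ᴿ_
infix  8 -ᴿ_

_+ᴿ_ : ℝ → ℝ → ℝ
x +ᴿ y = mkℝ (λ n → seq x n ℚ.+ seq y n) (cauchy-+ (seq x) (seq y) (cauchy x) (cauchy y))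

-ᴿ_ : ℝ → ℝ
-ᴿ x = mkℝ (λ n → ℚ.- seq x n) (cauchy-neg (seq x) (cauchy x))

_-ᴿ_ : ℝ → ℝ → ℝ
x -ᴿ y = x +ᴿ (-ᴿ y)

_*ᴿ_ : ℝ → ℝ → ℝ
x *ᴿ y = mkℝ (λ n → seq x n ℚ.* seq y n) (cauchy-* (seq x) (seq y) (cauchy x) (cauchy y))

sumᴿ productᴿ : List ℝ → ℝ
sumᴿ     = foldr _+ᴿ_ 0ᴿ
productᴿ = foldr _*ᴿ_ 1ᴿ

∑ℕ : ∀ {m} → (Fin m → ℕ) → ℕ
∑ℕ = sum ℕ.+-0-rawMonoid

∑ℚ : ∀ {m} → (Fin m → ℚ) → ℚ
∑ℚ = sum ℚ.+-0-rawMonoid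

count : ∀ {m} → (Fin m → Bool) → ℕ
count f = ∑ℕ (λ v → if f v then 1 else 0)

-- Labelled simple graphs on the vertex set Fin m.  In r ∷ G, the row r
-- tells which of the vertices 1, …, m are adjacent to vertex 0, and G is
-- the graph induced on the vertices 1, …, m.  Each labelled simple graph
-- is thus represented exactly once.
infixr 5 _∷_

data Graph : ℕ → Set where
  []  : Graph 0
  _∷_ : ∀ {m} → Vec Bool m → Graph m → Graph (suc m)

adjacent : ∀ {m} → Graph m → Fin m → Fin m → Bool
adjacent (r ∷ G) zero    zero    = false
adjacent (r ∷ G) zero    (suc v) = lookup r v
adjacent (r ∷ G) (suc u) zero    = lookup r u
adjacent (r ∷ G) (suc u) (suc v) = adjacent G u v

allRows : ∀ m → List (Vec Bool m)
allRows zero    = [] ∷ []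
allRows (suc m) = cartesianProductWith _∷_ (true ∷ false ∷ []) (allRows m)

allGraphs : ∀ m → List (Graph m)
allGraphs zero    = [] ∷ []
allGraphs (suc m) = cartesianProductWith _∷_ (allRows m) (allGraphs m)

-- All pairs (u , v) with u < v, i.e. each unordered pair of distinct
-- vertices once.
pairs : ∀ m → List (Fin m × Fin m)
pairs zero    = []
pairs (suc m) = map (λ v → zero , suc v) (allFin m)
             ++ map (Product.map suc suc) (pairs m)

-- The probability that the random graph equals G, when each pair u, v is
-- an edge independently with probability π u v.
weight : ∀ {m} → (Fin m → Fin m → ℝ) → Graph m → ℝ
weight {m} π G = productᴿ
  (map (λ (u , v) → if adjacent G u v then π u v else 1ᴿ -ᴿ π u v) (pairs m))

Pr : ∀ {m} → (Fin m → Fin m → ℝ) → {P : Pred (Graph m) 0ℓ} → Decidable P → ℝ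
Pr {m} π P? = sumᴿ (map (weight π) (filter P? (allGraphs m)))

Balanced : ∀ {m k} → ℕ → (Fin m → Fin k) → Set
Balanced n Ψ = ∀ c → count (λ v → does (Ψ v Fin.≟ c)) ≡ n

plantedPartition : ∀ {m k} → (Fin m → Fin k) → ℝ → ℝ → Fin m → Fin m → ℝ
plantedPartition Ψ p q u v = if does (Ψ u Fin.≟ Ψ v) then p else q

-- One-step transition probabilities for the walk moving from u to v with
-- probability proportional to w u v, and staying at u if all the weights
-- at u are zero.
transition : ∀ {m} → (Fin m → Fin m → ℕ) → Fin m → Fin m → ℚ
transition w u v = go (∑ℕ (w u))
  where
  go : ℕ → ℚ
  go zero      = if does (u Fin.≟ v) then 1ℚ else 0ℚ
  go t@(suc _) = + w u v / t

unitWeight : ∀ {m} → Graph m → Fin m → Fin m → ℕ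
unitWeight G u v = if adjacent G u v then 1 else 0

triangles : ∀ {m} → Graph m → Fin m → Fin m → ℕ
triangles G u v = count (λ x → adjacent G u v ∧ adjacent G u x ∧ adjacent G v x)

-- Pr (Ψ(Z_{t+1}) = Ψ(Z_t) | Z_t = u) for the walk Z with weights w.
sameClusterProbability : ∀ {m k} → (Fin m → Fin k) → (Fin m → Fin m → ℕ) → Fin m → ℚ
sameClusterProbability Ψ w u =
  ∑ℚ (λ v → if does (Ψ v Fin.≟ Ψ u) then transition w u v else 0ℚ)

TriangleWalkStaysInClusterMore : ∀ {m k} → (Fin m → Fin k) → Graph m → Set
TriangleWalkStaysInClusterMore Ψ G = ∀ u →
  sameClusterProbability Ψ (unitWeight G) u ℚ.< sameClusterProbability Ψ (triangles G) u

triangleWalkStaysInClusterMore? : ∀ {m k} (Ψ : Fin m → Fin k) → Decidable (TriangleWalkStaysInClusterMore Ψ)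
triangleWalkStaysInClusterMore? Ψ G = Fin.all? λ u →
  sameClusterProbability Ψ (unitWeight G) u ℚ.<? sameClusterProbability Ψ (triangles G) u

{-# OPTIONS --safe #-}
module Submission where

-- Write A for the adjacency matrix and N for the cluster size, and fix a
-- vertex u.  Let a and b be the numbers of neighbours of u inside and outside
-- its cluster, and let S and D be the total triangle weights of the edges from
-- u to these two kinds of neighbours.  The two walks stay in the cluster with
-- probabilities a / (a + b) and S / (S + D), so the claim at u is a D < b S
-- (walkComparison): an edge inside the cluster is, on average, in more
-- triangles than an edge that leaves it.
--
-- An edge from u to v lies in sum over x of A u x * A v x triangles.  Given the
-- neighbourhood of u, the expectation of this sum is about (p - q) d + q (a + b),
-- where d is the number of neighbours of u in the cluster of v.  Now d is about
-- p N if v is in the cluster of u and about q N otherwise, which makes a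
-- difference of order (p - q)² N (rate-gap).  Therefore u satisfies the
-- inequality as soon as the degrees of u into the clusters deviate from their
-- means by at most θ N and the weights S and D deviate from their conditional
-- means by at most θ³ N², for a small constant θ (regular⇒stays).
--
-- For these deviations, second moments suffice.  The deviation of S or D is a
-- sum over v, x of terms A u v * A u x * M v x, with M the centred adjacency
-- matrix, and terms on different pairs v x are orthogonal, so the second moment
-- has order N² only (E-pathDeviation²).  The degree deviation T satisfies
-- T² ≤ U + N, where U is the sum of the products M u v * M u x over v ≢ x in
-- the cluster; again the terms are orthogonal, and the second moment of U has
-- order N² (E-offDiagonal², degreeDeviation²).  Adding the squares over all
-- vertices and clusters gives a random variable with expectation of order N³,
-- which, for large N, exceeds θ⁶ N⁴ whenever some vertex violates the
-- inequality.  Markov's inequality bounds the probability of this by a constant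
-- over N (concentration).
--
-- All of this takes place over the rationals and is uniform in p and q.  The
-- n-th approximation of the real probability is a rational expectation for the
-- n-th approximations of p and q (seq-Pr).  These may exceed 1 slightly if
-- p = 1; the approximation of p is then replaced by 1, at a cost controlled by
-- the Lipschitz bound E-close.

open import Defs
open import Algebra.Bundles using (module CommutativeRing)
import Algebra.Properties.Semiring.Sum as SemiringSum
open import Data.Bool.Base using (Bool; true; false; _∧_; not; if_then_else_)
open import Data.Empty using (⊥-elim)
open import Data.Fin.Base using (Fin; zero; suc)
import Data.Fin.Properties as Fin
import Data.Integer.Base as ℤ
import Data.Integer.Properties as ℤ
open import Data.List.Base using (List; []; _∷_; _++_; map; filter; tabulate; allFin; cartesianProductWith)
open import Data.Nat.Base as ℕ using (ℕ; zero; suc)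
import Data.Nat.Properties as ℕ
open import Data.Product.Base using (_×_; _,_; proj₁; proj₂; ∃-syntax)
open import Data.Rational.Base
open import Data.Rational.Properties
import Data.Rational.Solver as Solver
open import Data.Rational.Unnormalised.Base as ℚᵘ using (mkℚᵘ; *≡*) renaming (_≃_ to _≃ᵘ_)
import Data.Rational.Unnormalised.Properties as ℚᵘ
open import Data.Sum.Base as Sum using (_⊎_; inj₁; inj₂)
open import Data.Vec.Base using (Vec; []; _∷_; lookup)
open import Function.Base using (_∘_)
open import Level using (0ℓ)
open import Relation.Binary.PropositionalEquality
open import Relation.Nullary.Decidable using (does; yes; no; Dec; _×-dec_; _⊎-dec_)
open import Relation.Nullary.Negation using (¬_)
open import Relation.Unary using (Pred; Decidable)

open Solver.+-*-Solver using (solve; con; _:+_; _:*_; _:-_; :-_; _:=_)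
private module Sums = SemiringSum (CommutativeRing.semiring +-*-commutativeRing)

-- Rational inequalities and finite sums

2ℚ 3ℚ 4ℚ : ℚ
2ℚ = 1ℚ + 1ℚ
3ℚ = 1ℚ + 2ℚ
4ℚ = 2ℚ + 2ℚ

-- The second argument is a certificate: an inequality is proved by exhibiting
-- its slack as a polynomial that is visibly non-negative.
≤-by : ∀ {x y} z → 0ℚ ≤ z → y ≡ x + z → x ≤ y
≤-by {x} z 0≤z refl = subst (_≤ x + z) (+-identityʳ x) (+-monoʳ-≤ x 0≤z)

<-by : ∀ {x y} z → 0ℚ < z → y ≡ x + z → x < y
<-by {x} z 0<z refl = subst (_< x + z) (+-identityʳ x) (+-monoʳ-< x 0<z)

p≤q⇒0≤q-p : ∀ {p q} → p ≤ q → 0ℚ ≤ q - p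
p≤q⇒0≤q-p {p} {q} p≤q = subst (_≤ q - p) (+-inverseʳ p) (+-monoˡ-≤ (- p) p≤q)

p<q⇒0<q-p : ∀ {p q} → p < q → 0ℚ < q - p
p<q⇒0<q-p {p} {q} p<q = subst (_< q - p) (+-inverseʳ p) (+-monoˡ-< (- p) p<q)

0≤p+q : ∀ {p q} → 0ℚ ≤ p → 0ℚ ≤ q → 0ℚ ≤ p + q
0≤p+q = +-mono-≤

0≤p*q : ∀ {p q} → 0ℚ ≤ p → 0ℚ ≤ q → 0ℚ ≤ p * q
0≤p*q {p} {q} 0≤p 0≤q = nonNegative⁻¹ (p * q)
  {{nonNeg*nonNeg⇒nonNeg p {{nonNegative 0≤p}} q {{nonNegative 0≤q}}}}

0<p*q : ∀ {p q} → 0ℚ < p → 0ℚ < q → 0ℚ < p * q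
0<p*q {p} {q} 0<p 0<q = positive⁻¹ (p * q)
  {{pos*pos⇒pos p {{positive 0<p}} q {{positive 0<q}}}}

≤-* : ∀ {p q} r → 0ℚ ≤ r → p ≤ q → r * p ≤ r * q
≤-* r 0≤r = *-monoˡ-≤-nonNeg r {{nonNegative 0≤r}}

*-mono-≤-nonNeg : ∀ {p q r s} → 0ℚ ≤ p → 0ℚ ≤ s → p ≤ q → r ≤ s → p * r ≤ q * s
*-mono-≤-nonNeg {p} {q} {r} {s} 0≤p 0≤s p≤q r≤s = ≤-trans
  (*-monoˡ-≤-nonNeg p {{nonNegative 0≤p}} r≤s)
  (*-monoʳ-≤-nonNeg s {{nonNegative 0≤s}} p≤q)

p≤∣p∣ : ∀ p → p ≤ ∣ p ∣
p≤∣p∣ p with ∣p∣≡p∨∣p∣≡-p p | ≤-total 0ℚ p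
... | inj₁ eq | _         = ≤-reflexive (sym eq)
... | inj₂ _  | inj₁ 0≤p  = ≤-reflexive (sym (0≤p⇒∣p∣≡p 0≤p))
... | inj₂ _  | inj₂ p≤0  = ≤-trans p≤0 (0≤∣p∣ p)

-p≤∣p∣ : ∀ p → - p ≤ ∣ p ∣
-p≤∣p∣ p = subst (- p ≤_) (∣-p∣≡∣p∣ p) (p≤∣p∣ (- p))

∣p∣≤-by : ∀ {p q} → p ≤ q → - p ≤ q → ∣ p ∣ ≤ q
∣p∣≤-by {p} p≤q -p≤q with ∣p∣≡p∨∣p∣≡-p p
... | inj₁ eq = subst (_≤ _) (sym eq) p≤q
... | inj₂ eq = subst (_≤ _) (sym eq) -p≤q

∣p*q∣≤1 : ∀ p q → ∣ p ∣ ≤ 1ℚ → ∣ q ∣ ≤ 1ℚ → ∣ p * q ∣ ≤ 1ℚ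
∣p*q∣≤1 p q ∣p∣≤1 ∣q∣≤1 = subst (_≤ 1ℚ) (sym (∣p*q∣≡∣p∣*∣q∣ p q))
  (*-mono-≤-nonNeg (0≤∣p∣ p) (nonNegative⁻¹ 1ℚ) ∣p∣≤1 ∣q∣≤1)

0≤p*p : ∀ p → 0ℚ ≤ p * p
0≤p*p p with ≤-total 0ℚ p
... | inj₁ 0≤p = 0≤p*q 0≤p 0≤p
... | inj₂ p≤0 = subst (0ℚ ≤_) (solve 1 (λ x → :- x :* :- x := x :* x) refl p)
  (0≤p*q (neg-antimono-≤ p≤0) (neg-antimono-≤ p≤0))

p*p≤q*q⇒∣p∣≤q : ∀ {p q} → 0ℚ < q → p * p ≤ q * q → ∣ p ∣ ≤ q
p*p≤q*q⇒∣p∣≤q {p} {q} 0<q p²≤q² = ∣p∣≤-by (bound p p²≤q²)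
  (bound (- p) (subst (_≤ q * q) (solve 1 (λ x → x :* x := :- x :* :- x) refl p) p²≤q²))
  where
  bound : ∀ r → r * r ≤ q * q → r ≤ q
  bound r r²≤q² = ≮⇒≥ λ q<r → <-irrefl refl (<-≤-trans
    (<-by ((r - q) * (r - q) + (q * (r - q) + q * (r - q)))
      (+-mono-≤-< (0≤p*p (r - q)) (+-mono-< (0<p*q 0<q (p<q⇒0<q-p q<r)) (0<p*q 0<q (p<q⇒0<q-p q<r))))
      (solve 2 (λ q r → r :* r := q :* q :+ ((r :- q) :* (r :- q) :+ (q :* (r :- q) :+ q :* (r :- q))))
        refl q r))
    r²≤q²)

-- The embedding of the natural numbers.
ι : ℕ → ℚ
ι zero    = 0ℚ
ι (suc n) = 1ℚ + ι n

-- The indicator of a truth value.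
χ : Bool → ℚ
χ true  = 1ℚ
χ false = 0ℚ

ι-+ : ∀ m n → ι (m ℕ.+ n) ≡ ι m + ι n
ι-+ zero    n = sym (+-identityˡ (ι n))
ι-+ (suc m) n = trans (cong (1ℚ +_) (ι-+ m n)) (sym (+-assoc 1ℚ (ι m) (ι n)))

ι-* : ∀ m n → ι (m ℕ.* n) ≡ ι m * ι n
ι-* zero    n = sym (*-zeroˡ (ι n))
ι-* (suc m) n = trans (ι-+ n (m ℕ.* n)) (trans (cong (ι n +_) (ι-* m n))
  (solve 2 (λ m n → n :+ m :* n := (con 1ℚ :+ m) :* n) refl (ι m) (ι n)))

0≤ι : ∀ n → 0ℚ ≤ ι n
0≤ι zero    = ≤-refl
0≤ι (suc n) = 0≤p+q (nonNegative⁻¹ 1ℚ) (0≤ι n)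

∑-cong : ∀ {m} {f g : Fin m → ℚ} → (∀ i → f i ≡ g i) → ∑ℚ f ≡ ∑ℚ g
∑-cong = Sums.sum-cong-≗

∑-+ : ∀ {m} (f g : Fin m → ℚ) → ∑ℚ (λ i → f i + g i) ≡ ∑ℚ f + ∑ℚ g
∑-+ = Sums.∑-distrib-+

∑-*ˡ : ∀ {m} c (f : Fin m → ℚ) → c * ∑ℚ f ≡ ∑ℚ (λ i → c * f i)
∑-*ˡ = Sums.*-distribˡ-sum

∑-*ʳ : ∀ {m} c (f : Fin m → ℚ) → ∑ℚ f * c ≡ ∑ℚ (λ i → f i * c)
∑-*ʳ = Sums.*-distribʳ-sum

∑-mono : ∀ {m} {f g : Fin m → ℚ} → (∀ i → f i ≤ g i) → ∑ℚ f ≤ ∑ℚ g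
∑-mono {zero}  f≤g = ≤-refl
∑-mono {suc m} f≤g = +-mono-≤ (f≤g zero) (∑-mono (λ i → f≤g (suc i)))

∑-const : ∀ m c → ∑ℚ {m} (λ _ → c) ≡ ι m * c
∑-const zero    c = sym (*-zeroˡ c)
∑-const (suc m) c = trans (cong (c +_) (∑-const m c))
  (solve 2 (λ m c → c :+ m :* c := (con 1ℚ :+ m) :* c) refl (ι m) c)

∑-zero : ∀ {m} {f : Fin m → ℚ} → (∀ i → f i ≡ 0ℚ) → ∑ℚ f ≡ 0ℚ
∑-zero {m} f≡0 = trans (∑-cong f≡0) (trans (∑-const m 0ℚ) (*-zeroʳ (ι m)))

∑-nonNeg : ∀ {m} {f : Fin m → ℚ} → (∀ i → 0ℚ ≤ f i) → 0ℚ ≤ ∑ℚ f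
∑-nonNeg {m} {f} 0≤f = subst (_≤ ∑ℚ f) (∑-zero {m} (λ _ → refl)) (∑-mono 0≤f)

term≤∑ : ∀ {m} {f : Fin m → ℚ} → (∀ i → 0ℚ ≤ f i) → ∀ i → f i ≤ ∑ℚ f
term≤∑ {f = f} 0≤f zero    = ≤-by (∑ℚ (f ∘ suc)) (∑-nonNeg (λ i → 0≤f (suc i))) refl
term≤∑ {f = f} 0≤f (suc i) = ≤-trans (term≤∑ (λ j → 0≤f (suc j)) i)
  (≤-by (f zero) (0≤f zero) (+-comm (f zero) _))

-- The Kronecker delta.
δ : ∀ {m} → Fin m → Fin m → ℚ
δ u v = χ (does (u Fin.≟ v))

∑-δ : ∀ {m} (u : Fin m) (f : Fin m → ℚ) → ∑ℚ (λ v → δ u v * f v) ≡ f u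
∑-δ zero f = trans
  (cong₂ _+_ (*-identityˡ (f zero)) (∑-zero (λ i → *-zeroˡ (f (suc i)))))
  (+-identityʳ (f zero))
∑-δ (suc u) f = trans (cong₂ _+_ (*-zeroˡ (f zero)) (∑-δ u (f ∘ suc))) (+-identityˡ (f (suc u)))

χ-∧ : ∀ a b → χ (a ∧ b) ≡ χ a * χ b
χ-∧ true  b = sym (*-identityˡ (χ b))
χ-∧ false b = sym (*-zeroˡ (χ b))

0≤χ : ∀ b → 0ℚ ≤ χ b
0≤χ true  = nonNegative⁻¹ 1ℚ
0≤χ false = ≤-refl

χ≤1 : ∀ b → χ b ≤ 1ℚ
χ≤1 true  = ≤-refl
χ≤1 false = nonNegative⁻¹ 1ℚ

χ-idem : ∀ b → χ b * χ b ≡ χ b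
χ-idem true  = *-identityˡ 1ℚ
χ-idem false = *-zeroˡ 0ℚ

ι-∑ : ∀ {m} (f : Fin m → ℕ) → ι (∑ℕ f) ≡ ∑ℚ (ι ∘ f)
ι-∑ {zero}  f = refl
ι-∑ {suc m} f = trans (ι-+ (f zero) _) (cong (ι (f zero) +_) (ι-∑ (f ∘ suc)))

ι-if : ∀ b → ι (if b then 1 else 0) ≡ χ b
ι-if true  = +-identityʳ 1ℚ
ι-if false = refl

ι-count : ∀ {m} (f : Fin m → Bool) → ι (count f) ≡ ∑ℚ (χ ∘ f)
ι-count f = trans (ι-∑ (λ v → if f v then 1 else 0)) (∑-cong (λ v → ι-if (f v)))

∑∑-* : ∀ {m n} (f : Fin m → ℚ) (g : Fin n → ℚ) →
  ∑ℚ f * ∑ℚ g ≡ ∑ℚ (λ i → ∑ℚ (λ j → f i * g j))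
∑∑-* f g = trans (∑-*ʳ (∑ℚ g) f) (∑-cong (λ i → ∑-*ˡ (f i) g))

-- Expectation over random graphs

-- The expectation of a function of a random row, in which entry v is true with
-- probability ρ v independently.  The definition makes sense for any rational
-- ρ, also outside the interval from 0 to 1; only monotonicity needs ρ to
-- consist of probabilities.
Erow : ∀ {m} → (Fin m → ℚ) → (Vec Bool m → ℚ) → ℚ
Erow {zero}  ρ F = F []
Erow {suc m} ρ F = ρ zero * Erow (ρ ∘ suc) (F ∘ (true ∷_))
                 + (1ℚ - ρ zero) * Erow (ρ ∘ suc) (F ∘ (false ∷_))

-- The expectation of a function of a random graph in which each pair u < v is
-- an edge with probability π u v independently.  The diagonal of π is not used.
E : ∀ {m} → (Fin m → Fin m → ℚ) → (Graph m → ℚ) → ℚ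
E {zero}  π F = F []
E {suc m} π F = Erow (π zero ∘ suc) (λ r → E (λ u v → π (suc u) (suc v)) (λ G → F (r ∷ G)))

Erow-cong : ∀ {m} (ρ : Fin m → ℚ) {F F′} → (∀ r → F r ≡ F′ r) → Erow ρ F ≡ Erow ρ F′
Erow-cong {zero}  ρ F≡F′ = F≡F′ []
Erow-cong {suc m} ρ F≡F′ = cong₂ (λ x y → ρ zero * x + (1ℚ - ρ zero) * y)
  (Erow-cong (ρ ∘ suc) (λ r → F≡F′ (true ∷ r))) (Erow-cong (ρ ∘ suc) (λ r → F≡F′ (false ∷ r)))

Erow-+ : ∀ {m} (ρ : Fin m → ℚ) F F′ → Erow ρ (λ r → F r + F′ r) ≡ Erow ρ F + Erow ρ F′
Erow-+ {zero}  ρ F F′ = refl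
Erow-+ {suc m} ρ F F′ = trans
  (cong₂ (λ x y → ρ zero * x + (1ℚ - ρ zero) * y)
    (Erow-+ (ρ ∘ suc) (F ∘ (true ∷_)) _) (Erow-+ (ρ ∘ suc) (F ∘ (false ∷_)) _))
  (solve 6 (λ p p̄ a b c d → p :* (a :+ b) :+ p̄ :* (c :+ d) := (p :* a :+ p̄ :* c) :+ (p :* b :+ p̄ :* d))
    refl (ρ zero) (1ℚ - ρ zero) _ _ _ _)

Erow-*ˡ : ∀ {m} (ρ : Fin m → ℚ) c F → Erow ρ (λ r → c * F r) ≡ c * Erow ρ F
Erow-*ˡ {zero}  ρ c F = refl
Erow-*ˡ {suc m} ρ c F = trans
  (cong₂ (λ x y → ρ zero * x + (1ℚ - ρ zero) * y)
    (Erow-*ˡ (ρ ∘ suc) c (F ∘ (true ∷_))) (Erow-*ˡ (ρ ∘ suc) c (F ∘ (false ∷_))))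
  (solve 5 (λ p p̄ a b c → p :* (c :* a) :+ p̄ :* (c :* b) := c :* (p :* a :+ p̄ :* b))
    refl (ρ zero) (1ℚ - ρ zero) _ _ c)

Erow-const : ∀ {m} (ρ : Fin m → ℚ) c → Erow ρ (λ _ → c) ≡ c
Erow-const {zero}  ρ c = refl
Erow-const {suc m} ρ c = trans
  (cong₂ (λ x y → ρ zero * x + (1ℚ - ρ zero) * y) (Erow-const (ρ ∘ suc) c) (Erow-const (ρ ∘ suc) c))
  (solve 2 (λ p c → p :* c :+ (con 1ℚ :- p) :* c := c) refl (ρ zero) c)

IsProb : ℚ → Set
IsProb x = 0ℚ ≤ x × x ≤ 1ℚ

Erow-mono : ∀ {m} {ρ : Fin m → ℚ} → (∀ v → IsProb (ρ v)) →
  ∀ {F F′} → (∀ r → F r ≤ F′ r) → Erow ρ F ≤ Erow ρ F′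
Erow-mono {zero}      hρ F≤F′ = F≤F′ []
Erow-mono {suc m} {ρ} hρ F≤F′ = +-mono-≤
  (*-monoˡ-≤-nonNeg (ρ zero) {{nonNegative (proj₁ (hρ zero))}}
    (Erow-mono (hρ ∘ suc) (λ r → F≤F′ (true ∷ r))))
  (*-monoˡ-≤-nonNeg (1ℚ - ρ zero) {{nonNegative (p≤q⇒0≤q-p (proj₂ (hρ zero)))}}
    (Erow-mono (hρ ∘ suc) (λ r → F≤F′ (false ∷ r))))

E-cong : ∀ {m} (π : Fin m → Fin m → ℚ) {F F′} → (∀ G → F G ≡ F′ G) → E π F ≡ E π F′
E-cong {zero}  π F≡F′ = F≡F′ []
E-cong {suc m} π F≡F′ = Erow-cong _ (λ r → E-cong _ (λ G → F≡F′ (r ∷ G)))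

E-+ : ∀ {m} (π : Fin m → Fin m → ℚ) F F′ → E π (λ G → F G + F′ G) ≡ E π F + E π F′
E-+ {zero}  π F F′ = refl
E-+ {suc m} π F F′ = trans
  (Erow-cong _ (λ r → E-+ _ (λ G → F (r ∷ G)) (λ G → F′ (r ∷ G)))) (Erow-+ (π zero ∘ suc) _ _)

E-*ˡ : ∀ {m} (π : Fin m → Fin m → ℚ) c F → E π (λ G → c * F G) ≡ c * E π F
E-*ˡ {zero}  π c F = refl
E-*ˡ {suc m} π c F = trans (Erow-cong _ (λ r → E-*ˡ _ c (λ G → F (r ∷ G)))) (Erow-*ˡ (π zero ∘ suc) c _)

E-const : ∀ {m} (π : Fin m → Fin m → ℚ) c → E π (λ _ → c) ≡ c
E-const {zero}  π c = refl
E-const {suc m} π c = trans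
  (Erow-cong (π zero ∘ suc) (λ r → E-const (λ u v → π (suc u) (suc v)) c)) (Erow-const (π zero ∘ suc) c)

E-mono : ∀ {m} {π : Fin m → Fin m → ℚ} → (∀ u v → IsProb (π u v)) →
  ∀ {F F′} → (∀ G → F G ≤ F′ G) → E π F ≤ E π F′
E-mono {zero}  hπ F≤F′ = F≤F′ []
E-mono {suc m} hπ F≤F′ = Erow-mono (λ v → hπ zero (suc v))
  (λ r → E-mono (λ u v → hπ (suc u) (suc v)) (λ G → F≤F′ (r ∷ G)))

E-∑ : ∀ {m n} (π : Fin m → Fin m → ℚ) (F : Fin n → Graph m → ℚ) →
  E π (λ G → ∑ℚ (λ i → F i G)) ≡ ∑ℚ (λ i → E π (F i))
E-∑ {n = zero}  π F = E-const π 0ℚ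
E-∑ {n = suc n} π F = trans (E-+ π (F zero) _) (cong (E π (F zero) +_) (E-∑ π (F ∘ suc)))

adjacent-sym : ∀ {m} (G : Graph m) u v → adjacent G u v ≡ adjacent G v u
adjacent-sym (r ∷ G) zero    zero    = refl
adjacent-sym (r ∷ G) zero    (suc v) = refl
adjacent-sym (r ∷ G) (suc u) zero    = refl
adjacent-sym (r ∷ G) (suc u) (suc v) = adjacent-sym G u v

adjacent-irrefl : ∀ {m} (G : Graph m) u → adjacent G u u ≡ false
adjacent-irrefl (r ∷ G) zero    = refl
adjacent-irrefl (r ∷ G) (suc u) = adjacent-irrefl G u

-- The unordered pairs of u, v and of x, y coincide.
SamePair : ∀ {m} → Fin m → Fin m → Fin m → Fin m → Set
SamePair u v x y = (x ≡ u × y ≡ v) ⊎ (x ≡ v × y ≡ u)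

samePair? : ∀ {m} (u v x y : Fin m) → Dec (SamePair u v x y)
samePair? u v x y = ((x Fin.≟ u) ×-dec (y Fin.≟ v)) ⊎-dec ((x Fin.≟ v) ×-dec (y Fin.≟ u))

-- F does not depend on whether u and v are adjacent.
IndependentOf : ∀ {m} → Fin m → Fin m → (Graph m → ℚ) → Set
IndependentOf u v F = ∀ G G′ →
  (∀ x y → ¬ SamePair u v x y → adjacent G x y ≡ adjacent G′ x y) → F G ≡ F G′

-- The expected adjacency matrix: π with its diagonal replaced by zero.
edgeProb : ∀ {m} → (Fin m → Fin m → ℚ) → Fin m → Fin m → ℚ
edgeProb π u v = if does (u Fin.≟ v) then 0ℚ else π u v

-- The adjacency matrix.
A : ∀ {m} → Graph m → Fin m → Fin m → ℚ
A G u v = χ (adjacent G u v)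

-- The centred adjacency matrix; its diagonal is zero.
M : ∀ {m} → (Fin m → Fin m → ℚ) → Graph m → Fin m → Fin m → ℚ
M π G u v = A G u v - edgeProb π u v

edgeProb-sym : ∀ {m} {π : Fin m → Fin m → ℚ} → (∀ u v → π u v ≡ π v u) →
  ∀ u v → edgeProb π u v ≡ edgeProb π v u
edgeProb-sym         π-sym zero    zero    = refl
edgeProb-sym         π-sym zero    (suc v) = π-sym zero (suc v)
edgeProb-sym         π-sym (suc u) zero    = π-sym (suc u) zero
edgeProb-sym {suc m} π-sym (suc u) (suc v) = edgeProb-sym {m} (λ x y → π-sym (suc x) (suc y)) u v

M-sym : ∀ {m} {π : Fin m → Fin m → ℚ} → (∀ u v → π u v ≡ π v u) →
  ∀ G u v → M π G u v ≡ M π G v u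
M-sym π-sym G u v = cong₂ _-_ (cong χ (adjacent-sym G u v)) (edgeProb-sym π-sym u v)

M-diag : ∀ {m} (π : Fin m → Fin m → ℚ) G u → M π G u u ≡ 0ℚ
M-diag π (r ∷ G) zero    = refl
M-diag π (r ∷ G) (suc u) = M-diag (λ x y → π (suc x) (suc y)) G u

Erow-centred : ∀ {m} (ρ : Fin m → ℚ) v (H : Vec Bool m → ℚ) →
  (∀ r r′ → (∀ w → ¬ w ≡ v → lookup r w ≡ lookup r′ w) → H r ≡ H r′) →
  Erow ρ (λ r → (χ (lookup r v) - ρ v) * H r) ≡ 0ℚ
Erow-centred {suc m} ρ zero H indep = begin
  ρ zero * Erow (ρ ∘ suc) (λ r → (1ℚ - ρ zero) * H (true ∷ r))
    + (1ℚ - ρ zero) * Erow (ρ ∘ suc) (λ r → (0ℚ - ρ zero) * H (false ∷ r))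
    ≡⟨ cong₂ (λ x y → ρ zero * x + (1ℚ - ρ zero) * y)
         (Erow-*ˡ (ρ ∘ suc) (1ℚ - ρ zero) _)
         (trans (Erow-*ˡ (ρ ∘ suc) (0ℚ - ρ zero) _) (cong ((0ℚ - ρ zero) *_) (Erow-cong (ρ ∘ suc) same))) ⟩
  ρ zero * ((1ℚ - ρ zero) * e) + (1ℚ - ρ zero) * ((0ℚ - ρ zero) * e)
    ≡⟨ solve 2 (λ p e → p :* ((con 1ℚ :- p) :* e) :+ (con 1ℚ :- p) :* ((con 0ℚ :- p) :* e) := con 0ℚ)
         refl (ρ zero) e ⟩
  0ℚ ∎
  where
  open ≡-Reasoning
  e = Erow (ρ ∘ suc) (λ r → H (true ∷ r))
  same : ∀ r → H (false ∷ r) ≡ H (true ∷ r)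
  same r = indep _ _ λ { zero 0≢0 → ⊥-elim (0≢0 refl) ; (suc w) _ → refl }
Erow-centred {suc m} ρ (suc v) H indep = trans
  (cong₂ (λ x y → ρ zero * x + (1ℚ - ρ zero) * y) (tail true) (tail false))
  (solve 1 (λ p → p :* con 0ℚ :+ (con 1ℚ :- p) :* con 0ℚ := con 0ℚ) refl (ρ zero))
  where
  tail : ∀ b → Erow (ρ ∘ suc) (λ r → (χ (lookup r v) - ρ (suc v)) * H (b ∷ r)) ≡ 0ℚ
  tail b = Erow-centred (ρ ∘ suc) v (λ r → H (b ∷ r)) λ r r′ agree → indep _ _
    λ { zero _ → refl ; (suc w) w≢v → agree w (λ w≡v → w≢v (cong suc w≡v)) }

-- A centred entry is uncorrelated with everything that does not depend on
-- that edge.  All use of independence goes through this lemma.  No assumption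
-- u ≢ v is needed, because the diagonal of M vanishes.
E-centred : ∀ {m} {π : Fin m → Fin m → ℚ} → (∀ u v → π u v ≡ π v u) →
  ∀ u v F → IndependentOf u v F → E π (λ G → M π G u v * F G) ≡ 0ℚ
E-centred {π = π} π-sym zero zero F indep = trans
  (E-cong π λ G → trans (cong (_* F G) (M-diag π G zero)) (*-zeroˡ (F G)))
  (E-const π 0ℚ)
E-centred {suc m} {π} π-sym zero (suc v) F indep = trans
  (Erow-cong _ (λ r → E-*ˡ _ (χ (lookup r v) - π zero (suc v)) (λ G → F (r ∷ G))))
  (Erow-centred (π zero ∘ suc) v (λ r → E _ (λ G → F (r ∷ G))) λ r r′ agree →
    E-cong _ λ G → indep (r ∷ G) (r′ ∷ G) λ
      { zero    zero    _ → refl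
      ; zero    (suc w) h → agree w (λ { refl → h (inj₁ (refl , refl)) })
      ; (suc w) zero    h → agree w (λ { refl → h (inj₂ (refl , refl)) })
      ; (suc _) (suc _) _ → refl })
E-centred {suc m} {π} π-sym (suc u) zero F indep = trans
  (E-cong π λ G → cong (_* F G) (M-sym π-sym G (suc u) zero))
  (E-centred π-sym zero (suc u) F λ G G′ agree → indep G G′ λ x y h → agree x y (h ∘ Sum.swap))
E-centred {suc m} {π} π-sym (suc u) (suc v) F indep = trans
  (Erow-cong _ λ r → E-centred {m} (λ x y → π-sym (suc x) (suc y)) u v (λ G → F (r ∷ G))
    λ G G′ agree → indep (r ∷ G) (r ∷ G′) λ
      { zero    zero    _ → refl
      ; zero    (suc _) _ → refl
      ; (suc _) zero    _ → refl
      ; (suc x) (suc y) h → agree x y (h ∘ Sum.map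
          (λ (x≡u , y≡v) → cong suc x≡u , cong suc y≡v) (λ (x≡v , y≡u) → cong suc x≡v , cong suc y≡u)) })
  (Erow-const (π zero ∘ suc) 0ℚ)

-- Second moments

E-∑∑ : ∀ {m n l} (π : Fin m → Fin m → ℚ) (F : Fin n → Fin l → Graph m → ℚ) →
  E π (λ G → ∑ℚ (λ i → ∑ℚ (λ j → F i j G))) ≡ ∑ℚ (λ i → ∑ℚ (λ j → E π (F i j)))
E-∑∑ π F = trans (E-∑ π (λ i G → ∑ℚ (λ j → F i j G))) (∑-cong (λ i → E-∑ π (F i)))

-- Orthogonality leaves at most two nonzero terms E (Y v x * Y v′ x′) for each
-- (v , x), so the second moment of the double sum has order m² rather than m⁴.
secondMoment : ∀ {m} {π : Fin m → Fin m → ℚ} → (∀ u v → IsProb (π u v)) →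
  (Y : Fin m → Fin m → Graph m → ℚ) → (∀ v x G → ∣ Y v x G ∣ ≤ 1ℚ) →
  (∀ v x v′ x′ → ¬ SamePair v x v′ x′ → E π (λ G → Y v x G * Y v′ x′ G) ≡ 0ℚ) →
  E π (λ G → ∑ℚ (λ v → ∑ℚ (λ x → Y v x G)) * ∑ℚ (λ v → ∑ℚ (λ x → Y v x G)))
    ≤ ι m * (ι m * 2ℚ)
secondMoment {m} {π} hπ Y ∣Y∣≤1 orthogonal = begin
  E π (λ G → S G * S G)
    ≡⟨ E-cong π (λ G → trans (∑-*ʳ (S G) (λ v → ∑ℚ λ x → Y v x G)) (∑-cong λ v →
         trans (∑-*ʳ (S G) (λ x → Y v x G)) (∑-cong λ x →
         trans (∑-*ˡ (Y v x G) (λ v′ → ∑ℚ λ x′ → Y v′ x′ G)) (∑-cong λ v′ →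
         ∑-*ˡ (Y v x G) (λ x′ → Y v′ x′ G))))) ⟩
  E π (λ G → ∑ℚ λ v → ∑ℚ λ x → ∑ℚ λ v′ → ∑ℚ λ x′ → Y v x G * Y v′ x′ G)
    ≡⟨ trans (E-∑∑ π (λ v x G → ∑ℚ λ v′ → ∑ℚ λ x′ → Y v x G * Y v′ x′ G))
         (∑-cong λ v → ∑-cong λ x → E-∑∑ π (λ v′ x′ G → Y v x G * Y v′ x′ G)) ⟩
  (∑ℚ λ v → ∑ℚ λ x → ∑ℚ λ v′ → ∑ℚ λ x′ → E π (λ G → Y v x G * Y v′ x′ G))
    ≤⟨ (∑-mono {m} λ v → ∑-mono {m} λ x → ∑-mono {m} λ v′ → ∑-mono {m} λ x′ → bound v x v′ x′) ⟩
  (∑ℚ {m} λ v → ∑ℚ {m} λ x → ∑ℚ {m} λ v′ → ∑ℚ {m} λ x′ → δ x x′ * δ v v′ + δ v x′ * δ x v′)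
    ≡⟨ (∑-cong {m} λ v → ∑-cong {m} λ x → twoPairs v x) ⟩
  ∑ℚ {m} (λ _ → ∑ℚ {m} (λ _ → 2ℚ))
    ≡⟨ trans (∑-cong {m} λ _ → ∑-const m 2ℚ) (∑-const m (ι m * 2ℚ)) ⟩
  ι m * (ι m * 2ℚ) ∎
  where
  open ≤-Reasoning
  S : Graph m → ℚ
  S G = ∑ℚ (λ v → ∑ℚ (λ x → Y v x G))

  0≤δδ : ∀ (a b c d : Fin m) → 0ℚ ≤ δ a b * δ c d
  0≤δδ a b c d = 0≤p*q (0≤χ (does (a Fin.≟ b))) (0≤χ (does (c Fin.≟ d)))

  YY≤1 : ∀ v x v′ x′ → E π (λ G → Y v x G * Y v′ x′ G) ≤ 1ℚ
  YY≤1 v x v′ x′ = subst (E π (λ G → Y v x G * Y v′ x′ G) ≤_) (E-const π 1ℚ) (E-mono hπ λ G →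
    ≤-trans (p≤∣p∣ (Y v x G * Y v′ x′ G)) (∣p*q∣≤1 (Y v x G) (Y v′ x′ G) (∣Y∣≤1 v x G) (∣Y∣≤1 v′ x′ G)))

  δ-refl : ∀ (a : Fin m) → δ a a ≡ 1ℚ
  δ-refl a with a Fin.≟ a
  ... | yes _  = refl
  ... | no a≢a = ⊥-elim (a≢a refl)

  δδ-refl : ∀ (a b : Fin m) → δ a a * δ b b ≡ 1ℚ
  δδ-refl a b = cong₂ _*_ (δ-refl a) (δ-refl b)

  bound : ∀ v x v′ x′ →
    E π (λ G → Y v x G * Y v′ x′ G) ≤ δ x x′ * δ v v′ + δ v x′ * δ x v′
  bound v x v′ x′ with samePair? v x v′ x′
  ... | yes (inj₁ (refl , refl)) = ≤-trans (YY≤1 v x v x)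
        (≤-by (δ v x * δ x v) (0≤δδ v x x v) (cong (_+ δ v x * δ x v) (δδ-refl x v)))
  ... | yes (inj₂ (refl , refl)) = ≤-trans (YY≤1 v x x v)
        (≤-by (δ x v * δ v x) (0≤δδ x v v x)
          (trans (cong (δ x v * δ v x +_) (δδ-refl v x)) (+-comm (δ x v * δ v x) 1ℚ)))
  ... | no distinct = subst (_≤ δ x x′ * δ v v′ + δ v x′ * δ x v′) (sym (orthogonal v x v′ x′ distinct))
        (0≤p+q (0≤δδ x x′ v v′) (0≤δδ v x′ x v′))

  twoPairs : ∀ v x →
    ∑ℚ (λ v′ → ∑ℚ (λ x′ → δ x x′ * δ v v′ + δ v x′ * δ x v′)) ≡ 2ℚ
  twoPairs v x = trans
    (∑-cong λ v′ → trans (∑-+ (λ x′ → δ x x′ * δ v v′) (λ x′ → δ v x′ * δ x v′))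
      (cong₂ _+_ (∑-δ x (λ _ → δ v v′)) (∑-δ v (λ _ → δ x v′))))
    (trans (∑-+ (δ v) (δ x)) (cong₂ _+_ (∑δ≡1 v) (∑δ≡1 x)))
    where
    ∑δ≡1 : ∀ a → ∑ℚ (δ a) ≡ 1ℚ
    ∑δ≡1 a = trans (∑-cong λ b → sym (*-identityʳ (δ a b))) (∑-δ a (λ _ → 1ℚ))

independent-* : ∀ {m} {u v : Fin m} {F F′ : Graph m → ℚ} →
  IndependentOf u v F → IndependentOf u v F′ → IndependentOf u v (λ G → F G * F′ G)
independent-* iF iF′ G G′ agree = cong₂ _*_ (iF G G′ agree) (iF′ G G′ agree)

independent-const : ∀ {m} {u v : Fin m} {c} → IndependentOf u v (λ _ → c)
independent-const _ _ _ = refl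

independent-A : ∀ {m} {u v x y : Fin m} → ¬ SamePair u v x y → IndependentOf u v (λ G → A G x y)
independent-A {x = x} {y} distinct G G′ agree = cong χ (agree x y distinct)

independent-M : ∀ {m} {π : Fin m → Fin m → ℚ} {u v x y} → ¬ SamePair u v x y →
  IndependentOf u v (λ G → M π G x y)
independent-M {π = π} {x = x} {y} distinct G G′ agree =
  cong (λ b → χ b - edgeProb π x y) (agree x y distinct)

∣χ∣≤1 : ∀ b → ∣ χ b ∣ ≤ 1ℚ
∣χ∣≤1 b = subst (_≤ 1ℚ) (sym (0≤p⇒∣p∣≡p (0≤χ b))) (χ≤1 b)

edgeProb-isProb : ∀ {m} {π : Fin m → Fin m → ℚ} → (∀ u v → IsProb (π u v)) →
  ∀ u v → IsProb (edgeProb π u v)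
edgeProb-isProb hπ u v with does (u Fin.≟ v)
... | true  = ≤-refl , nonNegative⁻¹ 1ℚ
... | false = hπ u v

∣M∣≤1 : ∀ {m} {π : Fin m → Fin m → ℚ} → (∀ u v → IsProb (π u v)) →
  ∀ G u v → ∣ M π G u v ∣ ≤ 1ℚ
∣M∣≤1 {π = π} hπ G u v = ∣p∣≤-by
  (≤-by ((1ℚ - a) + s) (0≤p+q (p≤q⇒0≤q-p (χ≤1 (adjacent G u v))) 0≤s)
    (solve 2 (λ a s → con 1ℚ := (a :- s) :+ ((con 1ℚ :- a) :+ s)) refl a s))
  (≤-by (a + (1ℚ - s)) (0≤p+q (0≤χ (adjacent G u v)) (p≤q⇒0≤q-p s≤1))
    (solve 2 (λ a s → con 1ℚ := :- (a :- s) :+ (a :+ (con 1ℚ :- s))) refl a s))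
  where
  a = A G u v
  s = edgeProb π u v
  0≤s = proj₁ (edgeProb-isProb hπ u v)
  s≤1 = proj₂ (edgeProb-isProb hπ u v)

-- The fluctuation of the g-weighted number of closed walks u, v, x, u of length
-- three that comes from the edge v x alone, the row of u being taken as it is.
pathDeviation : ∀ {m} → (Fin m → Fin m → ℚ) → (Fin m → ℚ) → Fin m → Graph m → ℚ
pathDeviation π g u G = ∑ℚ (λ v → ∑ℚ (λ x → g v * (A G u v * A G u x) * M π G v x))

A-irrefl : ∀ {m} (G : Graph m) u → A G u u ≡ 0ℚ
A-irrefl G u = cong χ (adjacent-irrefl G u)

E-zero : ∀ {m} (π : Fin m → Fin m → ℚ) {F} → (∀ G → F G ≡ 0ℚ) → E π F ≡ 0ℚ
E-zero π F≡0 = trans (E-cong π F≡0) (E-const π 0ℚ)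

-- Two terms on different pairs v x and v′ x′ are orthogonal: M v x is
-- independent of the other term and of all the entries in the row of u, unless
-- u is v or x, when the term vanishes.
E-pathDeviation² : ∀ {m} {π : Fin m → Fin m → ℚ} → (∀ u v → IsProb (π u v)) →
  (∀ u v → π u v ≡ π v u) → ∀ g → (∀ v → ∣ g v ∣ ≤ 1ℚ) → ∀ u →
  E π (λ G → pathDeviation π g u G * pathDeviation π g u G) ≤ ι m * (ι m * 2ℚ)
E-pathDeviation² {m} {π} hπ π-sym g ∣g∣≤1 u = secondMoment hπ Y ∣Y∣≤1 orthogonal
  where
  Y : Fin m → Fin m → Graph m → ℚ
  Y v x G = g v * (A G u v * A G u x) * M π G v x

  ∣Y∣≤1 : ∀ v x G → ∣ Y v x G ∣ ≤ 1ℚ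
  ∣Y∣≤1 v x G = ∣p*q∣≤1 (g v * (A G u v * A G u x)) (M π G v x)
    (∣p*q∣≤1 (g v) (A G u v * A G u x) (∣g∣≤1 v)
      (∣p*q∣≤1 (A G u v) (A G u x) (∣χ∣≤1 (adjacent G u v)) (∣χ∣≤1 (adjacent G u x))))
    (∣M∣≤1 hπ G v x)

  orthogonal : ∀ v x v′ x′ → ¬ SamePair v x v′ x′ → E π (λ G → Y v x G * Y v′ x′ G) ≡ 0ℚ
  orthogonal v x v′ x′ distinct with u Fin.≟ v | u Fin.≟ x
  ... | yes refl | _ = E-zero π λ G → trans
        (cong (λ z → g v * (z * A G u x) * M π G v x * Y v′ x′ G) (A-irrefl G u))
        (solve 4 (λ g a m y → g :* (con 0ℚ :* a) :* m :* y := con 0ℚ) refl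
          (g v) (A G u x) (M π G v x) (Y v′ x′ G))
  ... | no _ | yes refl = E-zero π λ G → trans
        (cong (λ z → g v * (A G u v * z) * M π G v x * Y v′ x′ G) (A-irrefl G u))
        (solve 4 (λ g a m y → g :* (a :* con 0ℚ) :* m :* y := con 0ℚ) refl
          (g v) (A G u v) (M π G v x) (Y v′ x′ G))
  ... | no u≢v | no u≢x = trans
        (E-cong π λ G → solve 3 (λ c m y → c :* m :* y := m :* (c :* y)) refl
          (g v * (A G u v * A G u x)) (M π G v x) (Y v′ x′ G))
        (E-centred π-sym v x (λ G → g v * (A G u v * A G u x) * Y v′ x′ G)
          (independent-* (independent-* (independent-const {c = g v}) (independent-* (atU v) (atU x)))
            (independent-* (independent-* (independent-const {c = g v′}) (independent-* (atU v′) (atU x′)))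
              (independent-M {π = π} distinct))))
        where
        atU : ∀ y → IndependentOf v x (λ G → A G u y)
        atU y = independent-A λ { (inj₁ (u≡v , _)) → u≢v u≡v ; (inj₂ (u≡x , _)) → u≢x u≡x }

-- The indicator of v ≢ x.
distinct : ∀ {m} → Fin m → Fin m → ℚ
distinct v x = χ (not (does (v Fin.≟ x)))

-- The deviation of the number of neighbours of u, weighted by h, from its mean.
degreeDeviation : ∀ {m} → (Fin m → Fin m → ℚ) → (Fin m → ℚ) → Fin m → Graph m → ℚ
degreeDeviation π h u G = ∑ℚ (λ v → M π G u v * h v)

-- The square of degreeDeviation without its diagonal terms.  Its second moment
-- has order m², which replaces a fourth moment bound on degreeDeviation.
offDiagonal : ∀ {m} → (Fin m → Fin m → ℚ) → (Fin m → ℚ) → Fin m → Graph m → ℚ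
offDiagonal π h u G =
  ∑ℚ (λ v → ∑ℚ (λ x → distinct v x * ((M π G u v * h v) * (M π G u x * h x))))

E-offDiagonal² : ∀ {m} {π : Fin m → Fin m → ℚ} → (∀ u v → IsProb (π u v)) →
  (∀ u v → π u v ≡ π v u) → ∀ h → (∀ v → ∣ h v ∣ ≤ 1ℚ) → ∀ u →
  E π (λ G → offDiagonal π h u G * offDiagonal π h u G) ≤ ι m * (ι m * 2ℚ)
E-offDiagonal² {m} {π} hπ π-sym h ∣h∣≤1 u = secondMoment hπ Y ∣Y∣≤1 orthogonal
  where
  Y : Fin m → Fin m → Graph m → ℚ
  Y v x G = distinct v x * ((M π G u v * h v) * (M π G u x * h x))

  ∣Y∣≤1 : ∀ v x G → ∣ Y v x G ∣ ≤ 1ℚ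
  ∣Y∣≤1 v x G = ∣p*q∣≤1 (distinct v x) ((M π G u v * h v) * (M π G u x * h x))
    (∣χ∣≤1 (not (does (v Fin.≟ x)))) (∣p*q∣≤1 (M π G u v * h v) (M π G u x * h x)
      (∣p*q∣≤1 (M π G u v) (h v) (∣M∣≤1 hπ G u v) (∣h∣≤1 v))
      (∣p*q∣≤1 (M π G u x) (h x) (∣M∣≤1 hπ G u x) (∣h∣≤1 x)))

  unpaired : ∀ v x y z → ¬ x ≡ v → ¬ y ≡ v → ¬ z ≡ v →
    E π (λ G → M π G u v * (M π G u x * (M π G u y * M π G u z))) ≡ 0ℚ
  unpaired v x y z x≢v y≢v z≢v = E-centred π-sym u v _
    (independent-* (other x x≢v) (independent-* (other y y≢v) (other z z≢v)))
    where
    other : ∀ w → ¬ w ≡ v → IndependentOf u v (λ G → M π G u w)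
    other w w≢v = independent-M {π = π}
      λ { (inj₁ (_ , w≡v)) → w≢v w≡v ; (inj₂ (u≡v , w≡u)) → w≢v (trans w≡u u≡v) }

  orthogonal : ∀ v x v′ x′ → ¬ SamePair v x v′ x′ → E π (λ G → Y v x G * Y v′ x′ G) ≡ 0ℚ
  orthogonal v x v′ x′ ¬same with v Fin.≟ x | v′ Fin.≟ x′
  ... | yes _ | _     = E-zero π λ G →
        solve 2 (λ y y′ → con 0ℚ :* y :* y′ := con 0ℚ) refl ((M π G u v * h v) * (M π G u x * h x)) _
  ... | no _  | yes _ = E-zero π λ G →
        solve 2 (λ y y′ → y :* (con 0ℚ :* y′) := con 0ℚ) refl
          (1ℚ * ((M π G u v * h v) * (M π G u x * h x))) ((M π G u v′ * h v′) * (M π G u x′ * h x′))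
  ... | no v≢x | no v′≢x′ = trans (trans (E-cong π rearrange) (E-*ˡ π c _))
        (trans (cong (c *_) E≡0) (*-zeroʳ c))
        where
        c = h v * h x * (h v′ * h x′)
        rearrange : ∀ G → 1ℚ * ((M π G u v * h v) * (M π G u x * h x))
            * (1ℚ * ((M π G u v′ * h v′) * (M π G u x′ * h x′)))
          ≡ c * (M π G u v * (M π G u x * (M π G u v′ * M π G u x′)))
        rearrange G = solve 8 (λ a b c d e f g h →
            con 1ℚ :* ((a :* e) :* (b :* f)) :* (con 1ℚ :* ((c :* g) :* (d :* h)))
            := e :* f :* (g :* h) :* (a :* (b :* (c :* d)))) refl
          (M π G u v) (M π G u x) (M π G u v′) (M π G u x′) (h v) (h x) (h v′) (h x′)
        E≡0 : E π (λ G → M π G u v * (M π G u x * (M π G u v′ * M π G u x′))) ≡ 0ℚ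
        E≡0 with v′ Fin.≟ v | x′ Fin.≟ v
        ... | no v′≢v | no x′≢v = unpaired v x v′ x′ (v≢x ∘ sym) v′≢v x′≢v
        ... | yes refl | _ = trans
              (E-cong π λ G → solve 3 (λ a b c → a :* (b :* c) := b :* (a :* c)) refl (M π G u v) (M π G u x) (M π G u v′ * M π G u x′))
              (unpaired x v v′ x′ v≢x v≢x (λ x′≡x → ¬same (inj₁ (refl , x′≡x))))
        ... | no _ | yes refl = trans
              (E-cong π λ G → solve 3 (λ a b c → a :* (b :* c) := b :* (a :* c)) refl (M π G u v) (M π G u x) (M π G u v′ * M π G u x′))
              (unpaired x v v′ x′ v≢x (λ v′≡x → ¬same (inj₂ (v′≡x , refl))) v≢x)

-- The diagonal terms of the square are at most 1 each, and only the v with f v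
-- contribute.
degreeDeviation² : ∀ {m} {π : Fin m → Fin m → ℚ} → (∀ u v → IsProb (π u v)) →
  ∀ (f : Fin m → Bool) u G → let h = χ ∘ f in
  degreeDeviation π h u G * degreeDeviation π h u G ≤ offDiagonal π h u G + ∑ℚ h
degreeDeviation² {m} {π} hπ f u G = begin
  ∑ℚ T * ∑ℚ T
    ≡⟨ ∑∑-* T T ⟩
  (∑ℚ λ v → ∑ℚ λ x → T v * T x)
    ≡⟨ (∑-cong λ v → trans (∑-cong λ x → split v x) (∑-+ (λ x → distinct v x * (T v * T x)) (λ x → δ v x * (T v * T x)))) ⟩
  (∑ℚ λ v → ∑ℚ (λ x → distinct v x * (T v * T x)) + ∑ℚ (λ x → δ v x * (T v * T x)))
    ≡⟨ ∑-+ (λ v → ∑ℚ (λ x → distinct v x * (T v * T x))) (λ v → ∑ℚ (λ x → δ v x * (T v * T x))) ⟩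
  offDiagonal π h u G + (∑ℚ λ v → ∑ℚ (λ x → δ v x * (T v * T x)))
    ≡⟨ cong (offDiagonal π h u G +_) (∑-cong λ v → ∑-δ v (λ x → T v * T x)) ⟩
  offDiagonal π h u G + ∑ℚ (λ v → T v * T v)
    ≤⟨ +-monoʳ-≤ (offDiagonal π h u G) (∑-mono square≤) ⟩
  offDiagonal π h u G + ∑ℚ h ∎
  where
  open ≤-Reasoning
  h = χ ∘ f
  T : Fin m → ℚ
  T v = M π G u v * h v

  split : ∀ v x → T v * T x ≡ distinct v x * (T v * T x) + δ v x * (T v * T x)
  split v x with does (v Fin.≟ x)
  ... | true  = solve 1 (λ t → t := con 0ℚ :* t :+ con 1ℚ :* t) refl (T v * T x)
  ... | false = solve 1 (λ t → t := con 1ℚ :* t :+ con 0ℚ :* t) refl (T v * T x)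

  square≤ : ∀ v → T v * T v ≤ h v
  square≤ v = begin
    T v * T v                         ≡⟨ solve 2 (λ m h → (m :* h) :* (m :* h) := m :* m :* (h :* h)) refl (M π G u v) (h v) ⟩
    M π G u v * M π G u v * (h v * h v) ≡⟨ cong (M π G u v * M π G u v *_) (χ-idem (f v)) ⟩
    M π G u v * M π G u v * h v       ≤⟨ *-monoʳ-≤-nonNeg (h v) {{nonNegative (0≤χ (f v))}}
                                           (≤-trans (p≤∣p∣ (M π G u v * M π G u v)) (∣p*q∣≤1 (M π G u v) (M π G u v) (∣M∣≤1 hπ G u v) (∣M∣≤1 hπ G u v))) ⟩
    1ℚ * h v                          ≡⟨ *-identityˡ (h v) ⟩
    h v                               ∎

-- One-step probabilities of weighted walks

-- The canonical representative of ι n has denominator 1.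
toℚᵘ-ι : ∀ n → toℚᵘ (ι n) ≃ᵘ mkℚᵘ (ℤ.+ n) 0
toℚᵘ-ι zero    = ℚᵘ.≃-refl
toℚᵘ-ι (suc n) = ℚᵘ.≃-trans (toℚᵘ-homo-+ 1ℚ (ι n))
  (ℚᵘ.≃-trans (ℚᵘ.+-congʳ (toℚᵘ 1ℚ) (toℚᵘ-ι n))
    (*≡* (cong (λ z → (ℤ.+ 1 ℤ.+ z) ℤ.* ℤ.+ 1) (ℤ.*-identityʳ (ℤ.+ n)))))

/-*-ι : ∀ n t → (ℤ.+ n / suc t) * ι (suc t) ≡ ι n
/-*-ι n t = toℚᵘ-injective (begin
  toℚᵘ ((ℤ.+ n / suc t) * ι (suc t))            ≈⟨ toℚᵘ-homo-* (ℤ.+ n / suc t) (ι (suc t)) ⟩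
  toℚᵘ (ℤ.+ n / suc t) ℚᵘ.* toℚᵘ (ι (suc t))    ≈⟨ ℚᵘ.*-cong (toℚᵘ-fromℚᵘ (mkℚᵘ (ℤ.+ n) t)) (toℚᵘ-ι (suc t)) ⟩
  mkℚᵘ (ℤ.+ n) t ℚᵘ.* mkℚᵘ (ℤ.+ suc t) 0        ≈⟨ *≡* (ℤ.*-assoc (ℤ.+ n) (ℤ.+ suc t) (ℤ.+ 1)) ⟩
  mkℚᵘ (ℤ.+ n) 0                                ≈⟨ toℚᵘ-ι n ⟨
  toℚᵘ (ι n)                                    ∎)
  where open ℚᵘ.≃-Reasoning

transition-* : ∀ {m} (w : Fin m → Fin m → ℕ) u v → 0ℚ < ι (∑ℕ (w u)) →
  transition w u v * ι (∑ℕ (w u)) ≡ ι (w u v)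
transition-* w u v 0<t with ∑ℕ (w u)
... | zero  = ⊥-elim (<-irrefl refl 0<t)
... | suc t = /-*-ι (w u v) t

sameClusterProbability-* : ∀ {m k} (Ψ : Fin m → Fin k) w u → 0ℚ < ι (∑ℕ (w u)) →
  sameClusterProbability Ψ w u * ι (∑ℕ (w u)) ≡ ∑ℚ (λ v → χ (does (Ψ v Fin.≟ Ψ u)) * ι (w u v))
sameClusterProbability-* Ψ w u 0<t = trans
  (∑-*ʳ (ι (∑ℕ (w u))) (λ v → if does (Ψ v Fin.≟ Ψ u) then transition w u v else 0ℚ)) (∑-cong term)
  where
  term : ∀ v → (if does (Ψ v Fin.≟ Ψ u) then transition w u v else 0ℚ) * ι (∑ℕ (w u))
             ≡ χ (does (Ψ v Fin.≟ Ψ u)) * ι (w u v)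
  term v with does (Ψ v Fin.≟ Ψ u)
  ... | true  = trans (transition-* w u v 0<t) (sym (*-identityˡ (ι (w u v))))
  ... | false = trans (*-zeroˡ (ι (∑ℕ (w u)))) (sym (*-zeroˡ (ι (w u v))))

fraction-< : ∀ {x y s t s′ t′} → x * t ≡ s → y * t′ ≡ s′ → 0ℚ < t → 0ℚ < t′ →
  s * t′ < s′ * t → x < y
fraction-< {x} {y} {t = t} {t′ = t′} refl refl 0<t 0<t′ st′<s′t =
  *-cancelʳ-<-nonNeg (t * t′) {{nonNegative (<⇒≤ (0<p*q 0<t 0<t′))}}
    (subst₂ _<_ (*-assoc x t t′)
      (solve 3 (λ y t t′ → y :* t′ :* t := y :* (t :* t′)) refl y t t′) st′<s′t)

-- Degrees and triangles in the planted partition model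

-- The edge probabilities of the planted partition model, for rational p and q.
plantedℚ : ∀ {m k} → (Fin m → Fin k) → ℚ → ℚ → Fin m → Fin m → ℚ
plantedℚ Ψ p q u v = if does (Ψ u Fin.≟ Ψ v) then p else q

plantedℚ-sym : ∀ {m k} (Ψ : Fin m → Fin k) p q u v → plantedℚ Ψ p q u v ≡ plantedℚ Ψ p q v u
plantedℚ-sym Ψ p q u v with Ψ u Fin.≟ Ψ v | Ψ v Fin.≟ Ψ u
... | yes _   | yes _   = refl
... | no _    | no _    = refl
... | yes eq  | no neq  = ⊥-elim (neq (sym eq))
... | no neq  | yes eq  = ⊥-elim (neq (sym eq))

plantedℚ-isProb : ∀ {m k} (Ψ : Fin m → Fin k) {p q} → IsProb p → IsProb q →
  ∀ u v → IsProb (plantedℚ Ψ p q u v)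
plantedℚ-isProb Ψ hp hq u v with does (Ψ u Fin.≟ Ψ v)
... | true  = hp
... | false = hq

-- Membership in the cluster c.
inCluster : ∀ {m k} → (Fin m → Fin k) → Fin k → Fin m → Bool
inCluster Ψ c v = does (Ψ v Fin.≟ c)

-- The number of neighbours v of u with f v.
degreeIn : ∀ {m} → (Fin m → Bool) → Fin m → Graph m → ℚ
degreeIn f u G = ∑ℚ (λ v → A G u v * χ (f v))

edgeProb≤π : ∀ {m} {π : Fin m → Fin m → ℚ} → (∀ u v → IsProb (π u v)) →
  ∀ u v → edgeProb π u v ≤ π u v
edgeProb≤π hπ u v with does (u Fin.≟ v)
... | true  = proj₁ (hπ u v)
... | false = ≤-refl

π-δ≤edgeProb : ∀ {m} {π : Fin m → Fin m → ℚ} → (∀ u v → IsProb (π u v)) →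
  ∀ u v → π u v - δ u v ≤ edgeProb π u v
π-δ≤edgeProb {π = π} hπ u v with does (u Fin.≟ v)
... | true  = ≤-by (1ℚ - π u v) (p≤q⇒0≤q-p (proj₂ (hπ u v)))
  (solve 1 (λ p → con 0ℚ := (p :- con 1ℚ) :+ (con 1ℚ :- p)) refl (π u v))
... | false = ≤-reflexive (+-identityʳ (π u v))

-- The expectation of degreeIn.
expectedDegree : ∀ {m} → (Fin m → Fin m → ℚ) → (Fin m → Bool) → Fin m → ℚ
expectedDegree π f u = ∑ℚ (λ v → edgeProb π u v * χ (f v))

degreeIn-split : ∀ {m} (π : Fin m → Fin m → ℚ) f u G →
  degreeIn f u G ≡ degreeDeviation π (χ ∘ f) u G + expectedDegree π f u
degreeIn-split π f u G = trans
  (∑-cong λ v → solve 3 (λ a e h → a :* h := (a :- e) :* h :+ e :* h) refl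
    (A G u v) (edgeProb π u v) (χ (f v)))
  (∑-+ (λ v → M π G u v * χ (f v)) (λ v → edgeProb π u v * χ (f v)))

module _ {m k} (Ψ : Fin m → Fin k) {p q : ℚ} (hp : IsProb p) (hq : IsProb q)
  {n} (balanced : Balanced n Ψ) where

  private
    π = plantedℚ Ψ p q
    hπ = plantedℚ-isProb Ψ hp hq

  clusterSize : ∀ c → ∑ℚ (χ ∘ inCluster Ψ c) ≡ ι n
  clusterSize c = trans (sym (ι-count (inCluster Ψ c))) (cong ι (balanced c))

  -- The probability of an edge between u and another vertex of the cluster c.
  rate : Fin m → Fin k → ℚ
  rate u c = if does (Ψ u Fin.≟ c) then p else q

  π-inCluster : ∀ u c v → π u v * χ (inCluster Ψ c v) ≡ rate u c * χ (inCluster Ψ c v)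
  π-inCluster u c v with Ψ v Fin.≟ c
  ... | yes refl = refl
  ... | no _     = trans (*-zeroʳ (π u v)) (sym (*-zeroʳ (rate u c)))

  ∑π-inCluster : ∀ u c → ∑ℚ (λ v → π u v * χ (inCluster Ψ c v)) ≡ rate u c * ι n
  ∑π-inCluster u c = trans (∑-cong (π-inCluster u c))
    (trans (sym (∑-*ˡ (rate u c) (χ ∘ inCluster Ψ c))) (cong (rate u c *_) (clusterSize c)))

  expectedDegree≤ : ∀ u c → expectedDegree π (inCluster Ψ c) u ≤ rate u c * ι n
  expectedDegree≤ u c = subst (expectedDegree π (inCluster Ψ c) u ≤_) (∑π-inCluster u c)
    (∑-mono λ v → *-monoʳ-≤-nonNeg (χ (inCluster Ψ c v)) {{nonNegative (0≤χ (inCluster Ψ c v))}}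
      (edgeProb≤π hπ u v))

  -- The error 1 is due to u itself, which is not among its own neighbours.
  expectedDegree≥ : ∀ u c → rate u c * ι n ≤ expectedDegree π (inCluster Ψ c) u + 1ℚ
  expectedDegree≥ u c = begin
    rate u c * ι n
      ≡⟨ ∑π-inCluster u c ⟨
    ∑ℚ (λ v → π u v * h v)
      ≤⟨ ∑-mono (λ v → ≤-by ((edgeProb π u v - (π u v - δ u v)) * h v)
           (0≤p*q (p≤q⇒0≤q-p (π-δ≤edgeProb hπ u v)) (0≤χ (inCluster Ψ c v)))
           (solve 4 (λ e p d h → e :* h :+ d :* h := p :* h :+ (e :- (p :- d)) :* h) refl
             (edgeProb π u v) (π u v) (δ u v) (h v))) ⟩
    ∑ℚ (λ v → edgeProb π u v * h v + δ u v * h v)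
      ≡⟨ ∑-+ (λ v → edgeProb π u v * h v) (λ v → δ u v * h v) ⟩
    expectedDegree π (inCluster Ψ c) u + ∑ℚ (λ v → δ u v * h v)
      ≡⟨ cong (expectedDegree π (inCluster Ψ c) u +_) (∑-δ u h) ⟩
    expectedDegree π (inCluster Ψ c) u + h u
      ≤⟨ +-monoʳ-≤ (expectedDegree π (inCluster Ψ c) u) (χ≤1 (inCluster Ψ c u)) ⟩
    expectedDegree π (inCluster Ψ c) u + 1ℚ ∎
    where
    open ≤-Reasoning
    h = χ ∘ inCluster Ψ c

  degreeIn≤ : ∀ u c G {e} → ∣ degreeDeviation π (χ ∘ inCluster Ψ c) u G ∣ ≤ e →
    degreeIn (inCluster Ψ c) u G ≤ rate u c * ι n + e
  degreeIn≤ u c G {e} ∣T∣≤e = begin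
    degreeIn (inCluster Ψ c) u G                      ≡⟨ degreeIn-split π (inCluster Ψ c) u G ⟩
    T + expectedDegree π (inCluster Ψ c) u            ≤⟨ +-mono-≤ (≤-trans (p≤∣p∣ T) ∣T∣≤e) (expectedDegree≤ u c) ⟩
    e + rate u c * ι n                                ≡⟨ +-comm e (rate u c * ι n) ⟩
    rate u c * ι n + e                                ∎
    where
    open ≤-Reasoning
    T = degreeDeviation π (χ ∘ inCluster Ψ c) u G

  degreeIn≥ : ∀ u c G {e} → ∣ degreeDeviation π (χ ∘ inCluster Ψ c) u G ∣ ≤ e →
    rate u c * ι n ≤ degreeIn (inCluster Ψ c) u G + (e + 1ℚ)
  degreeIn≥ u c G {e} ∣T∣≤e = begin
    rate u c * ι n              ≤⟨ expectedDegree≥ u c ⟩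
    d̄ + 1ℚ                      ≤⟨ ≤-by (e - - T) (p≤q⇒0≤q-p (≤-trans (-p≤∣p∣ T) ∣T∣≤e))
                                     (solve 3 (λ t d e → (t :+ d) :+ (e :+ con 1ℚ) := (d :+ con 1ℚ) :+ (e :- (:- t))) refl T d̄ e) ⟩
    (T + d̄) + (e + 1ℚ)          ≡⟨ cong (_+ (e + 1ℚ)) (degreeIn-split π (inCluster Ψ c) u G) ⟨
    degreeIn (inCluster Ψ c) u G + (e + 1ℚ) ∎
    where
    open ≤-Reasoning
    T = degreeDeviation π (χ ∘ inCluster Ψ c) u G
    d̄ = expectedDegree π (inCluster Ψ c) u

-- The number of ordered pairs v, x that form a triangle with u and satisfy f v,
-- that is, the total triangle weight of the edges from u to the vertices in f.
pathCount : ∀ {m} → (Fin m → Bool) → Fin m → Graph m → ℚ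
pathCount f u G = ∑ℚ (λ v → ∑ℚ (λ x → χ (f v) * (A G u v * A G u x) * A G v x))

-- The expected number of edges from v to the neighbours of u, for a given set
-- of neighbours.
expectedPaths : ∀ {m} → (Fin m → Fin m → ℚ) → Fin m → Fin m → Graph m → ℚ
expectedPaths π u v G = ∑ℚ (λ x → A G u x * edgeProb π v x)

pathCount-split : ∀ {m} (π : Fin m → Fin m → ℚ) f u G →
  pathCount f u G ≡ ∑ℚ (λ v → (A G u v * χ (f v)) * expectedPaths π u v G) + pathDeviation π (χ ∘ f) u G
pathCount-split π f u G = trans
  (∑-cong λ v → trans
    (∑-cong λ x → solve 5 (λ g a b m e → g :* (a :* b) :* m
        := (a :* g) :* (b :* e) :+ g :* (a :* b) :* (m :- e)) refl
      (χ (f v)) (A G u v) (A G u x) (A G v x) (edgeProb π v x))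
    (trans (∑-+ (λ x → (A G u v * χ (f v)) * (A G u x * edgeProb π v x))
                (λ x → χ (f v) * (A G u v * A G u x) * M π G v x))
      (cong (_+ ∑ℚ (λ x → χ (f v) * (A G u v * A G u x) * M π G v x))
        (sym (∑-*ˡ (A G u v * χ (f v)) (λ x → A G u x * edgeProb π v x))))))
  (∑-+ (λ v → (A G u v * χ (f v)) * expectedPaths π u v G)
       (λ v → ∑ℚ (λ x → χ (f v) * (A G u v * A G u x) * M π G v x)))

weightedDegree≤ : ∀ {m} (f : Fin m → Bool) u G (R : Fin m → ℚ) r → (∀ v → f v ≡ true → R v ≤ r) →
  ∑ℚ (λ v → (A G u v * χ (f v)) * R v) ≤ degreeIn f u G * r
weightedDegree≤ f u G R r R≤r = subst (∑ℚ (λ v → (A G u v * χ (f v)) * R v) ≤_)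
  (sym (∑-*ʳ r (λ v → A G u v * χ (f v)))) (∑-mono term)
  where
  term : ∀ v → (A G u v * χ (f v)) * R v ≤ (A G u v * χ (f v)) * r
  term v with f v in eq
  ... | true  = *-monoˡ-≤-nonNeg (A G u v * 1ℚ)
    {{nonNegative (0≤p*q (0≤χ (adjacent G u v)) (0≤χ true))}} (R≤r v eq)
  ... | false = ≤-reflexive (solve 3 (λ a x y → (a :* con 0ℚ) :* x := (a :* con 0ℚ) :* y) refl (A G u v) (R v) r)

-- The form in which the missing loop at v enters: R v falls short of r by at
-- most A u v, which costs at most 1 for each of the neighbours in f.
weightedDegree≥ : ∀ {m} (f : Fin m → Bool) u G (R : Fin m → ℚ) r →
  (∀ v → f v ≡ true → r ≤ R v + A G u v) →
  degreeIn f u G * r ≤ ∑ℚ (λ v → (A G u v * χ (f v)) * R v) + degreeIn f u G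
weightedDegree≥ f u G R r r≤R+A = subst₂ _≤_
  (sym (∑-*ʳ r (λ v → A G u v * χ (f v))))
  (∑-+ (λ v → (A G u v * χ (f v)) * R v) (λ v → A G u v * χ (f v)))
  (∑-mono term)
  where
  term : ∀ v → (A G u v * χ (f v)) * r ≤ (A G u v * χ (f v)) * R v + A G u v * χ (f v)
  term v with f v in eq
  ... | true  = ≤-trans (*-monoˡ-≤-nonNeg (A G u v * 1ℚ)
        {{nonNegative (0≤p*q (0≤χ (adjacent G u v)) (0≤χ true))}}
        (≤-trans (r≤R+A v eq) (+-monoʳ-≤ (R v) (χ≤1 (adjacent G u v)))))
      (≤-reflexive (solve 2 (λ a r → (a :* con 1ℚ) :* (r :+ con 1ℚ) := (a :* con 1ℚ) :* r :+ a :* con 1ℚ) refl (A G u v) (R v)))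
  ... | false = ≤-reflexive (solve 3 (λ a r s → (a :* con 0ℚ) :* r := (a :* con 0ℚ) :* s :+ a :* con 0ℚ) refl (A G u v) r (R v))

-- The number of neighbours of u.
degree : ∀ {m} → Fin m → Graph m → ℚ
degree u G = ∑ℚ (A G u)

module _ {m k} (Ψ : Fin m → Fin k) {p q : ℚ} (hp : IsProb p) (hq : IsProb q) where

  private
    π = plantedℚ Ψ p q
    hπ = plantedℚ-isProb Ψ hp hq

  ∑Aπ : ∀ u v G → ∑ℚ (λ x → A G u x * π v x) ≡
    (p - q) * degreeIn (inCluster Ψ (Ψ v)) u G + q * degree u G
  ∑Aπ u v G = trans (∑-cong term) (trans
    (∑-+ (λ x → (p - q) * (A G u x * χ (inCluster Ψ (Ψ v) x))) (λ x → q * A G u x))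
    (sym (cong₂ _+_ (∑-*ˡ (p - q) (λ x → A G u x * χ (inCluster Ψ (Ψ v) x))) (∑-*ˡ q (A G u)))))
    where
    term : ∀ x → A G u x * π v x ≡ (p - q) * (A G u x * χ (inCluster Ψ (Ψ v) x)) + q * A G u x
    term x = trans (cong (A G u x *_) (plantedℚ-sym Ψ p q v x)) (byCases (does (Ψ x Fin.≟ Ψ v)))
      where
      byCases : ∀ b → A G u x * (if b then p else q) ≡ (p - q) * (A G u x * χ b) + q * A G u x
      byCases true  = solve 3 (λ a p q → a :* p := (p :- q) :* (a :* con 1ℚ) :+ q :* a) refl (A G u x) p q
      byCases false = solve 3 (λ a p q → a :* q := (p :- q) :* (a :* con 0ℚ) :+ q :* a) refl (A G u x) p q

  expectedPaths≤ : ∀ u v G → expectedPaths π u v G ≤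
    (p - q) * degreeIn (inCluster Ψ (Ψ v)) u G + q * degree u G
  expectedPaths≤ u v G = subst (expectedPaths π u v G ≤_) (∑Aπ u v G)
    (∑-mono λ x → *-monoˡ-≤-nonNeg (A G u x) {{nonNegative (0≤χ (adjacent G u x))}} (edgeProb≤π hπ v x))

  expectedPaths≥ : ∀ u v G →
    (p - q) * degreeIn (inCluster Ψ (Ψ v)) u G + q * degree u G ≤ expectedPaths π u v G + A G u v
  expectedPaths≥ u v G = begin
    (p - q) * degreeIn (inCluster Ψ (Ψ v)) u G + q * degree u G
      ≡⟨ ∑Aπ u v G ⟨
    ∑ℚ (λ x → A G u x * π v x)
      ≤⟨ ∑-mono (λ x → ≤-by (A G u x * (edgeProb π v x - (π v x - δ v x)))
           (0≤p*q (0≤χ (adjacent G u x)) (p≤q⇒0≤q-p (π-δ≤edgeProb hπ v x)))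
           (solve 4 (λ a e p d → a :* e :+ d :* a := a :* p :+ a :* (e :- (p :- d))) refl
             (A G u x) (edgeProb π v x) (π v x) (δ v x))) ⟩
    ∑ℚ (λ x → A G u x * edgeProb π v x + δ v x * A G u x)
      ≡⟨ ∑-+ (λ x → A G u x * edgeProb π v x) (λ x → δ v x * A G u x) ⟩
    expectedPaths π u v G + ∑ℚ (λ x → δ v x * A G u x)
      ≡⟨ cong (expectedPaths π u v G +_) (∑-δ v (A G u)) ⟩
    expectedPaths π u v G + A G u v ∎
    where open ≤-Reasoning

  -- The term a on the right accounts for the missing loops at the a neighbours
  -- of u in its own cluster.
  pathCount-in≥ : ∀ u G → let a = degreeIn (inCluster Ψ (Ψ u)) u G in
    a * ((p - q) * a + q * degree u G) + pathDeviation π (χ ∘ inCluster Ψ (Ψ u)) u G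
      ≤ pathCount (inCluster Ψ (Ψ u)) u G + a
  pathCount-in≥ u G = begin
    a * r + W
      ≤⟨ +-monoˡ-≤ W (weightedDegree≥ f u G (λ v → expectedPaths π u v G) r bound) ⟩
    (∑ℚ (λ v → (A G u v * χ (f v)) * expectedPaths π u v G) + a) + W
      ≡⟨ solve 3 (λ s a w → (s :+ a) :+ w := (s :+ w) :+ a) refl
           (∑ℚ (λ v → (A G u v * χ (f v)) * expectedPaths π u v G)) a W ⟩
    (∑ℚ (λ v → (A G u v * χ (f v)) * expectedPaths π u v G) + W) + a
      ≡⟨ cong (_+ a) (pathCount-split π f u G) ⟨
    pathCount f u G + a ∎
    where
    open ≤-Reasoning
    f = inCluster Ψ (Ψ u)
    a = degreeIn f u G
    r = (p - q) * a + q * degree u G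
    W = pathDeviation π (χ ∘ f) u G
    bound : ∀ v → f v ≡ true → r ≤ expectedPaths π u v G + A G u v
    bound v fv with Ψ v Fin.≟ Ψ u
    ... | yes eq = subst (λ c → (p - q) * degreeIn (inCluster Ψ c) u G + q * degree u G
                           ≤ expectedPaths π u v G + A G u v) eq (expectedPaths≥ u v G)
    bound v () | no _

  pathCount-out≤ : ∀ u G d → q ≤ p → (∀ c → ¬ Ψ u ≡ c → degreeIn (inCluster Ψ c) u G ≤ d) →
    let f = not ∘ inCluster Ψ (Ψ u) in
    pathCount f u G ≤
      degreeIn f u G * ((p - q) * d + q * degree u G) + pathDeviation π (χ ∘ f) u G
  pathCount-out≤ u G d q≤p d-max = subst (_≤ degreeIn f u G * r + W) (sym (pathCount-split π f u G))
    (+-monoˡ-≤ W (weightedDegree≤ f u G (λ v → expectedPaths π u v G) r bound))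
    where
    f = not ∘ inCluster Ψ (Ψ u)
    r = (p - q) * d + q * degree u G
    W = pathDeviation π (χ ∘ f) u G
    bound : ∀ v → f v ≡ true → expectedPaths π u v G ≤ r
    bound v fv with Ψ v Fin.≟ Ψ u
    bound v () | yes _
    ... | no neq = ≤-trans (expectedPaths≤ u v G) (+-monoˡ-≤ (q * degree u G)
            (*-monoˡ-≤-nonNeg (p - q) {{nonNegative (p≤q⇒0≤q-p q≤p)}} (d-max (Ψ v) (neq ∘ sym))))

-- Regular vertices

crossMultiply : ∀ {a b S D s d} → 0ℚ < a → 0ℚ < b → a * s ≤ S → D ≤ b * d → d < s → a * D < b * S
crossMultiply {a} {b} {S} {D} {s} {d} 0<a 0<b as≤S D≤bd d<s = begin-strict
  a * D         ≤⟨ ≤-* a (<⇒≤ 0<a) D≤bd ⟩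
  a * (b * d)   ≡⟨ *-assoc a b d ⟨
  a * b * d     <⟨ *-monoʳ-<-pos (a * b) {{positive (0<p*q 0<a 0<b)}} d<s ⟩
  a * b * s     ≡⟨ solve 3 (λ a b s → a :* b :* s := b :* (a :* s)) refl a b s ⟩
  b * (a * s)   ≤⟨ ≤-* b (<⇒≤ 0<b) as≤S ⟩
  b * S         ∎
  where open ≤-Reasoning

-- The comparison at the heart of the argument, with y = q * degree u.  The left
-- side bounds from above the average triangle weight of an edge from u to
-- another cluster, where u has at most (q + θ) N neighbours; the right side
-- bounds from below that of an edge inside the cluster of u, where u has
-- a ≥ (p - 2 θ) N neighbours.  The terms θ² N absorb the fluctuations.
rate-gap : ∀ {p q θ N a} → 0ℚ ≤ θ → 0ℚ ≤ N → q + 4ℚ * θ ≤ p → 1ℚ ≤ θ * (θ * N) →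
  p * N ≤ a + (θ * N + θ * N) → ∀ y →
  (p - q) * ((q + θ) * N) + y + θ * (θ * N) < (p - q) * a + y - 1ℚ - θ * (θ * N)
rate-gap {p} {q} {θ} {N} {a} 0≤θ 0≤N gap 1≤θθN a-large y =
  -- With g = p - q - 4 θ, after replacing a by its lower bound there remains
  -- (p - q) (p - q - 3 θ) N = g² N + 5 θ g N + 4 θ² N, and 4 θ² N exceeds
  -- 1 + 2 θ² N.
  <-by ((p - q) * (a + (θ * N + θ * N) - p * N)
      + ((p - (q + 4ℚ * θ)) * (p - (q + 4ℚ * θ)) * N + ((4ℚ + 1ℚ) * θ * ((p - (q + 4ℚ * θ)) * N)
      + ((θ * (θ * N) - 1ℚ) + θ * (θ * N)))))
    (+-mono-≤-< (0≤p*q 0≤p-q (p≤q⇒0≤q-p a-large))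
      (+-mono-≤-< (0≤p*q (0≤p*p (p - (q + 4ℚ * θ))) 0≤N)
      (+-mono-≤-< (0≤p*q (0≤p*q (nonNegative⁻¹ (4ℚ + 1ℚ)) 0≤θ) (0≤p*q 0≤gap 0≤N))
      (+-mono-≤-< (p≤q⇒0≤q-p 1≤θθN) (<-≤-trans (positive⁻¹ 1ℚ) 1≤θθN)))))
    (solve 6 (λ p q θ N a y → 
      (p :- q) :* a :+ y :- con 1ℚ :- θ :* (θ :* N)
      := ((p :- q) :* ((q :+ θ) :* N) :+ y :+ θ :* (θ :* N))
       :+ ((p :- q) :* (a :+ (θ :* N :+ θ :* N) :- p :* N)
      :+ ((p :- (q :+ con 4ℚ :* θ)) :* (p :- (q :+ con 4ℚ :* θ)) :* N
        :+ (con (4ℚ + 1ℚ) :* θ :* ((p :- (q :+ con 4ℚ :* θ)) :* N)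
      :+ ((θ :* (θ :* N) :- con 1ℚ) :+ θ :* (θ :* N)))))) refl p q θ N a y)
  where
  0≤gap : 0ℚ ≤ p - (q + 4ℚ * θ)
  0≤gap = p≤q⇒0≤q-p gap
  0≤p-q : 0ℚ ≤ p - q
  0≤p-q = p≤q⇒0≤q-p (≤-trans (≤-by (4ℚ * θ) (0≤p*q (nonNegative⁻¹ 4ℚ) 0≤θ) refl) gap)

ι-triangles : ∀ {m} (G : Graph m) u v →
  ι (triangles G u v) ≡ ∑ℚ (λ x → A G u v * A G u x * A G v x)
ι-triangles G u v = trans (ι-count (λ x → adjacent G u v ∧ adjacent G u x ∧ adjacent G v x))
  (∑-cong λ x → trans (χ-∧ (adjacent G u v) (adjacent G u x ∧ adjacent G v x))
    (trans (cong (A G u v *_) (χ-∧ (adjacent G u x) (adjacent G v x)))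
      (sym (*-assoc (A G u v) (A G u x) (A G v x)))))

∑-complement : ∀ {m} (f : Fin m → Bool) (g : Fin m → ℚ) →
  ∑ℚ g ≡ ∑ℚ (λ v → χ (f v) * g v) + ∑ℚ (λ v → χ (not (f v)) * g v)
∑-complement f g = trans (∑-cong λ v → term (f v) (g v))
  (∑-+ (λ v → χ (f v) * g v) (λ v → χ (not (f v)) * g v))
  where
  term : ∀ b x → x ≡ χ b * x + χ (not b) * x
  term true  x = solve 1 (λ x → x := con 1ℚ :* x :+ con 0ℚ :* x) refl x
  term false x = solve 1 (λ x → x := con 0ℚ :* x :+ con 1ℚ :* x) refl x

∑-triangles : ∀ {m} (f : Fin m → Bool) u (G : Graph m) →
  ∑ℚ (λ v → χ (f v) * ι (triangles G u v)) ≡ pathCount f u G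
∑-triangles f u G = ∑-cong λ v → trans (cong (χ (f v) *_) (ι-triangles G u v))
  (trans (∑-*ˡ (χ (f v)) (λ x → A G u v * A G u x * A G v x))
    (∑-cong λ x → sym (*-assoc (χ (f v)) (A G u v * A G u x) (A G v x))))

∑-unitWeight : ∀ {m} (f : Fin m → Bool) u (G : Graph m) →
  ∑ℚ (λ v → χ (f v) * ι (unitWeight G u v)) ≡ degreeIn f u G
∑-unitWeight f u G = ∑-cong λ v →
  trans (cong (χ (f v) *_) (ι-if (adjacent G u v))) (*-comm (χ (f v)) (A G u v))

0≤pathCount : ∀ {m} (f : Fin m → Bool) u (G : Graph m) → 0ℚ ≤ pathCount f u G
0≤pathCount f u G = ∑-nonNeg λ v → ∑-nonNeg λ x →
  0≤p*q (0≤p*q (0≤χ (f v)) (0≤p*q (0≤χ (adjacent G u v)) (0≤χ (adjacent G u x)))) (0≤χ (adjacent G v x))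

-- The inequality between the walks at u, as a comparison of the triangle weights
-- inside and outside the cluster with the corresponding degrees.
walkComparison : ∀ {m k} (Ψ : Fin m → Fin k) (G : Graph m) u →
  let inside = inCluster Ψ (Ψ u) ; outside = not ∘ inside in
  0ℚ < degreeIn inside u G → 0ℚ < degreeIn outside u G →
  degreeIn inside u G * pathCount outside u G < degreeIn outside u G * pathCount inside u G →
  sameClusterProbability Ψ (unitWeight G) u < sameClusterProbability Ψ (triangles G) u
walkComparison Ψ G u 0<a 0<b aD<bS = fraction-<
  (trans (sameClusterProbability-* Ψ (unitWeight G) u (subst (0ℚ <_) (sym degree≡) 0<a+b))
    (∑-unitWeight inside u G))
  (trans (sameClusterProbability-* Ψ (triangles G) u (subst (0ℚ <_) (sym total≡) 0<S+D))
    (∑-triangles inside u G))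
  (subst (0ℚ <_) (sym degree≡) 0<a+b)
  (subst (0ℚ <_) (sym total≡) 0<S+D)
  (subst₂ (λ x y → a * x < S * y) (sym total≡) (sym degree≡) cross)
  where
  inside = inCluster Ψ (Ψ u)
  outside = not ∘ inside
  a = degreeIn inside u G
  b = degreeIn outside u G
  S = pathCount inside u G
  D = pathCount outside u G

  0<a+b : 0ℚ < a + b
  0<a+b = +-mono-< 0<a 0<b

  0<S : 0ℚ < S
  0<S = *-cancelˡ-<-nonNeg b {{nonNegative (<⇒≤ 0<b)}}
    (subst (_< b * S) (sym (*-zeroʳ b))
      (≤-<-trans (0≤p*q (<⇒≤ 0<a) (0≤pathCount outside u G)) aD<bS))

  0<S+D : 0ℚ < S + D
  0<S+D = +-mono-<-≤ 0<S (0≤pathCount outside u G)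

  degree≡ : ι (∑ℕ (unitWeight G u)) ≡ a + b
  degree≡ = trans (ι-∑ (unitWeight G u)) (trans (∑-complement inside (ι ∘ unitWeight G u))
    (cong₂ _+_ (∑-unitWeight inside u G) (∑-unitWeight outside u G)))

  total≡ : ι (∑ℕ (triangles G u)) ≡ S + D
  total≡ = trans (ι-∑ (triangles G u)) (trans (∑-complement inside (ι ∘ triangles G u))
    (cong₂ _+_ (∑-triangles inside u G) (∑-triangles outside u G)))

  cross : a * (S + D) < S * (a + b)
  cross = <-by (b * S - a * D) (p<q⇒0<q-p aD<bS)
    (solve 4 (λ a b S D → S :* (a :+ b) := a :* (S :+ D) :+ (b :* S :- a :* D)) refl a b S D)

otherCluster : ∀ {k} → 2 ℕ.≤ k → ∀ (c : Fin k) → ∃[ c′ ] ¬ c ≡ c′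
otherCluster {suc (suc k)} _ zero    = suc zero , λ ()
otherCluster {suc (suc k)} _ (suc c) = zero , λ ()
otherCluster {suc zero} (ℕ.s≤s ())

module _ {m k} (2≤k : 2 ℕ.≤ k) (Ψ : Fin m → Fin k) {p q : ℚ} (hp : IsProb p) (hq : IsProb q)
  {n} (balanced : Balanced n Ψ) {θ} (0<θ : 0ℚ < θ) (3θ≤q : 3ℚ * θ ≤ q) (gap : q + 4ℚ * θ ≤ p)
  (large : 1ℚ ≤ θ * (θ * ι n)) where

  private
    π = plantedℚ Ψ p q
    hπ = plantedℚ-isProb Ψ hp hq
    N = ι n
    0≤θ = <⇒≤ 0<θ

    0≤N : 0ℚ ≤ N
    0≤N = 0≤ι n

    θ≤1 : θ ≤ 1ℚ
    θ≤1 = ≤-trans (≤-by (θ + θ) (0≤p+q 0≤θ 0≤θ)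
      (solve 1 (λ θ → con 3ℚ :* θ := θ :+ (θ :+ θ)) refl θ)) (≤-trans 3θ≤q (proj₂ hq))

    1≤θN : 1ℚ ≤ θ * N
    1≤θN = ≤-trans large (subst (θ * (θ * N) ≤_) (*-identityˡ (θ * N))
      (*-monoʳ-≤-nonNeg (θ * N) {{nonNegative (0≤p*q 0≤θ 0≤N)}} θ≤1))

    q≤p : q ≤ p
    q≤p = ≤-trans (≤-by (4ℚ * θ) (0≤p*q (nonNegative⁻¹ 4ℚ) 0≤θ) refl) gap

  -- A vertex whose degrees into the clusters and whose triangle counts are close
  -- to their expected values satisfies the inequality between the two walks.
  regular⇒stays : ∀ u G →
    (∀ c → ∣ degreeDeviation π (χ ∘ inCluster Ψ c) u G ∣ ≤ θ * N) →
    ∣ pathDeviation π (χ ∘ inCluster Ψ (Ψ u)) u G ∣ ≤ θ * (θ * N) * (θ * N) →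
    ∣ pathDeviation π (χ ∘ not ∘ inCluster Ψ (Ψ u)) u G ∣ ≤ θ * (θ * N) * (θ * N) →
    sameClusterProbability Ψ (unitWeight G) u < sameClusterProbability Ψ (triangles G) u
  regular⇒stays u G ∣T∣≤ ∣W∣≤ ∣W′∣≤ = walkComparison Ψ G u 0<a 0<b
    (crossMultiply 0<a 0<b S-lower D-upper (rate-gap 0≤θ 0≤N gap large a-large (q * degree u G)))
    where
    open ≤-Reasoning
    inside = inCluster Ψ (Ψ u)
    outside = not ∘ inside
    a = degreeIn inside u G
    b = degreeIn outside u G
    W = pathDeviation π (χ ∘ inside) u G
    W′ = pathDeviation π (χ ∘ outside) u G
    Y = q * degree u G
    e = θ * (θ * N)

    rate-own : rate Ψ hp hq balanced u (Ψ u) ≡ p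
    rate-own with Ψ u Fin.≟ Ψ u
    ... | yes _  = refl
    ... | no neq = ⊥-elim (neq refl)

    rate-other : ∀ c → ¬ Ψ u ≡ c → rate Ψ hp hq balanced u c ≡ q
    rate-other c neq with Ψ u Fin.≟ c
    ... | yes eq = ⊥-elim (neq eq)
    ... | no _   = refl

    lower : ∀ c → rate Ψ hp hq balanced u c * N ≤ degreeIn (inCluster Ψ c) u G + (θ * N + θ * N)
    lower c = ≤-trans (degreeIn≥ Ψ hp hq balanced u c G (∣T∣≤ c))
      (+-monoʳ-≤ (degreeIn (inCluster Ψ c) u G) (+-monoʳ-≤ (θ * N) 1≤θN))

    a-large : p * N ≤ a + (θ * N + θ * N)
    a-large = subst (λ r → r * N ≤ a + (θ * N + θ * N)) rate-own (lower (Ψ u))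

    θN≤ : ∀ {r d} → 3ℚ * θ ≤ r → r * N ≤ d + (θ * N + θ * N) → θ * N ≤ d
    θN≤ {r} {d} 3θ≤r rN≤ = ≤-by ((d + (θ * N + θ * N) - r * N) + (r - 3ℚ * θ) * N)
      (0≤p+q (p≤q⇒0≤q-p rN≤) (0≤p*q (p≤q⇒0≤q-p 3θ≤r) 0≤N))
      (solve 4 (λ θ N r d → d := θ :* N :+ ((d :+ (θ :* N :+ θ :* N) :- r :* N) :+ (r :- con 3ℚ :* θ) :* N))
        refl θ N r d)

    θN≤a : θ * N ≤ a
    θN≤a = θN≤ (≤-trans 3θ≤q q≤p) a-large

    other = otherCluster 2≤k (Ψ u)
    c′ = proj₁ other

    inOther≤outside : ∀ v → χ (inCluster Ψ c′ v) ≤ χ (outside v)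
    inOther≤outside v with Ψ v Fin.≟ c′ | Ψ v Fin.≟ Ψ u
    ... | yes eq | yes eq′ = ⊥-elim (proj₂ other (trans (sym eq′) eq))
    ... | yes _  | no _    = ≤-refl
    ... | no _   | w       = 0≤χ (not (does w))

    θN≤b : θ * N ≤ b
    θN≤b = ≤-trans (θN≤ 3θ≤q (subst (λ r → r * N ≤ degreeIn (inCluster Ψ c′) u G + (θ * N + θ * N))
                     (rate-other c′ (proj₂ other)) (lower c′)))
      (∑-mono λ v → ≤-* (A G u v) (0≤χ (adjacent G u v)) (inOther≤outside v))

    0<θN : 0ℚ < θ * N
    0<θN = <-≤-trans (positive⁻¹ 1ℚ) 1≤θN

    0<a : 0ℚ < a
    0<a = <-≤-trans 0<θN θN≤a

    0<b : 0ℚ < b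
    0<b = <-≤-trans 0<θN θN≤b

    0≤e : 0ℚ ≤ e
    0≤e = 0≤p*q 0≤θ (0≤p*q 0≤θ 0≤N)

    S-lower : a * ((p - q) * a + Y - 1ℚ - e) ≤ pathCount inside u G
    S-lower = ≤-by ((pathCount inside u G + a - (a * ((p - q) * a + Y) + W)) + (a * e - - W))
      (0≤p+q (p≤q⇒0≤q-p (pathCount-in≥ Ψ hp hq u G)) (p≤q⇒0≤q-p (begin
        - W             ≤⟨ -p≤∣p∣ W ⟩
        ∣ W ∣           ≤⟨ ∣W∣≤ ⟩
        e * (θ * N)     ≤⟨ ≤-* e 0≤e θN≤a ⟩
        e * a           ≡⟨ *-comm e a ⟩
        a * e           ∎)))
      (solve 5 (λ S a x w e → S := a :* (x :- con 1ℚ :- e)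
          :+ ((S :+ a :- (a :* x :+ w)) :+ (a :* e :- (:- w)))) refl
        (pathCount inside u G) a ((p - q) * a + Y) W e)

    D-upper : pathCount outside u G ≤ b * ((p - q) * ((q + θ) * N) + Y + e)
    D-upper = begin
      pathCount outside u G
        ≤⟨ pathCount-out≤ Ψ hp hq u G ((q + θ) * N) q≤p d-max ⟩
      b * ((p - q) * ((q + θ) * N) + Y) + W′
        ≤⟨ +-monoʳ-≤ (b * ((p - q) * ((q + θ) * N) + Y))
             (≤-trans (p≤∣p∣ W′) (≤-trans ∣W′∣≤ (≤-* e 0≤e θN≤b))) ⟩
      b * ((p - q) * ((q + θ) * N) + Y) + e * b
        ≡⟨ solve 3 (λ b x e → b :* x :+ e :* b := b :* (x :+ e)) refl b ((p - q) * ((q + θ) * N) + Y) e ⟩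
      b * ((p - q) * ((q + θ) * N) + Y + e) ∎
      where
      d-max : ∀ c → ¬ Ψ u ≡ c → degreeIn (inCluster Ψ c) u G ≤ (q + θ) * N
      d-max c neq = subst (degreeIn (inCluster Ψ c) u G ≤_)
        (trans (cong (λ r → r * N + θ * N) (rate-other c neq)) (sym (*-distribʳ-+ N q θ)))
        (degreeIn≤ Ψ hp hq balanced u c G (∣T∣≤ c))

-- Concentration for rational probabilities

-- The sum of the squares of the quantities that have to be small at u: the
-- fluctuations of the triangle weights towards the cluster of u and towards the
-- other clusters, and the off-diagonal parts of the squared deviations of the
-- degrees into the clusters.
irregularityAt : ∀ {m k} → (Fin m → Fin m → ℚ) → (Fin m → Fin k) → Fin m → Graph m → ℚ
irregularityAt π Ψ u G = (W * W + W′ * W′) + ∑ℚ λ c → U c * U c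
  where
  W  = pathDeviation π (χ ∘ inCluster Ψ (Ψ u)) u G
  W′ = pathDeviation π (χ ∘ not ∘ inCluster Ψ (Ψ u)) u G
  U  = λ c → offDiagonal π (χ ∘ inCluster Ψ c) u G

-- The single random variable to which Markov's inequality is applied; when it
-- is small, all the vertices are regular at once.
irregularity : ∀ {m k} → (Fin m → Fin m → ℚ) → (Fin m → Fin k) → Graph m → ℚ
irregularity π Ψ G = ∑ℚ λ u → irregularityAt π Ψ u G

0≤irregularityAt : ∀ {m k} π (Ψ : Fin m → Fin k) G u → 0ℚ ≤ irregularityAt π Ψ u G
0≤irregularityAt π Ψ G u = 0≤p+q
  (0≤p+q (0≤p*p (pathDeviation π (χ ∘ inCluster Ψ (Ψ u)) u G))
         (0≤p*p (pathDeviation π (χ ∘ not ∘ inCluster Ψ (Ψ u)) u G)))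
  (∑-nonNeg λ c → 0≤p*p (offDiagonal π (χ ∘ inCluster Ψ c) u G))

E-irregularity : ∀ {m k} (Ψ : Fin m → Fin k) {p q} → IsProb p → IsProb q →
  let B = ι m * (ι m * 2ℚ) in
  E (plantedℚ Ψ p q) (irregularity (plantedℚ Ψ p q) Ψ) ≤ ι m * ((B + B) + ι k * B)
E-irregularity {m} {k} Ψ {p} {q} hp hq = begin
  E π (irregularity π Ψ)
    ≡⟨ E-∑ π (irregularityAt π Ψ) ⟩
  ∑ℚ (λ u → E π (irregularityAt π Ψ u))
    ≤⟨ ∑-mono bound ⟩
  ∑ℚ {m} (λ _ → (B + B) + ι k * B)
    ≡⟨ ∑-const m ((B + B) + ι k * B) ⟩
  ι m * ((B + B) + ι k * B) ∎
  where
  open ≤-Reasoning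
  π = plantedℚ Ψ p q
  hπ = plantedℚ-isProb Ψ hp hq
  π-sym = plantedℚ-sym Ψ p q
  B = ι m * (ι m * 2ℚ)
  W W′ : Fin m → Graph m → ℚ
  W u = pathDeviation π (χ ∘ inCluster Ψ (Ψ u)) u
  W′ u = pathDeviation π (χ ∘ not ∘ inCluster Ψ (Ψ u)) u
  U : Fin m → Fin k → Graph m → ℚ
  U u c = offDiagonal π (χ ∘ inCluster Ψ c) u
  bound : ∀ u → E π (irregularityAt π Ψ u) ≤ (B + B) + ι k * B
  bound u = begin
    E π (irregularityAt π Ψ u)
      ≡⟨ E-+ π (λ G → W u G * W u G + W′ u G * W′ u G) (λ G → ∑ℚ (λ c → U u c G * U u c G)) ⟩
    E π (λ G → W u G * W u G + W′ u G * W′ u G) + E π (λ G → ∑ℚ (λ c → U u c G * U u c G))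
      ≡⟨ cong₂ _+_ (E-+ π (λ G → W u G * W u G) (λ G → W′ u G * W′ u G))
           (E-∑ π (λ c G → U u c G * U u c G)) ⟩
    (E π (λ G → W u G * W u G) + E π (λ G → W′ u G * W′ u G)) + ∑ℚ (λ c → E π (λ G → U u c G * U u c G))
      ≤⟨ +-mono-≤
           (+-mono-≤
             (E-pathDeviation² hπ π-sym _ (λ v → ∣χ∣≤1 (inCluster Ψ (Ψ u) v)) u)
             (E-pathDeviation² hπ π-sym _ (λ v → ∣χ∣≤1 (not (inCluster Ψ (Ψ u) v))) u))
           (∑-mono λ c → E-offDiagonal² hπ π-sym _ (λ v → ∣χ∣≤1 (inCluster Ψ c v)) u) ⟩
    (B + B) + ∑ℚ {k} (λ _ → B)
      ≡⟨ cong ((B + B) +_) (∑-const k B) ⟩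
    (B + B) + ι k * B ∎

-- The indicator of the event that all vertices satisfy the inequality.
good : ∀ {m k} → (Fin m → Fin k) → Graph m → ℚ
good Ψ G = χ (does (triangleWalkStaysInClusterMore? Ψ G))

module _ {m k} (2≤k : 2 ℕ.≤ k) (Ψ : Fin m → Fin k) {p q : ℚ} (hp : IsProb p) (hq : IsProb q)
  {n} (balanced : Balanced n Ψ) {θ} (0<θ : 0ℚ < θ) (3θ≤q : 3ℚ * θ ≤ q) (gap : q + 4ℚ * θ ≤ p)
  (large : 2ℚ ≤ θ * (θ * ι n)) where

  private
    π = plantedℚ Ψ p q
    hπ = plantedℚ-isProb Ψ hp hq
    N = ι n
    0≤θ = <⇒≤ 0<θ
    -- The admissible size of the fluctuations of quadratic quantities.
    D = θ * (θ * N) * (θ * N)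

    1≤θθN : 1ℚ ≤ θ * (θ * N)
    1≤θθN = ≤-trans (≤-by 1ℚ (nonNegative⁻¹ 1ℚ) refl) large

    3θ≤1 : 3ℚ * θ ≤ 1ℚ
    3θ≤1 = ≤-trans 3θ≤q (proj₂ hq)

    0<θθN : 0ℚ < θ * (θ * N)
    0<θθN = <-≤-trans (positive⁻¹ 1ℚ) 1≤θθN

    0<θN : 0ℚ < θ * N
    0<θN = *-cancelˡ-<-nonNeg θ {{nonNegative 0≤θ}} (subst (_< θ * (θ * N)) (sym (*-zeroʳ θ)) 0<θθN)

    0<D : 0ℚ < D
    0<D = 0<p*q 0<θθN 0<θN

    -- This is where θ ≤ 1 / 3 and 2 ≤ θ² N are needed.
    D+N≤θN² : D + N ≤ θ * N * (θ * N)
    D+N≤θN² = ≤-by ((1ℚ - 3ℚ * θ + (θ + θ)) * N * (θ * (θ * N) - 2ℚ) + N * (1ℚ - 3ℚ * θ + θ))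
      (0≤p+q
        (0≤p*q (0≤p*q (0≤p+q 0≤g (0≤p+q 0≤θ 0≤θ)) (0≤ι n)) (p≤q⇒0≤q-p large))
        (0≤p*q (0≤ι n) (0≤p+q 0≤g 0≤θ)))
      (solve 2 (λ θ N → θ :* N :* (θ :* N) := (θ :* (θ :* N) :* (θ :* N) :+ N)
        :+ ((con 1ℚ :- con 3ℚ :* θ :+ (θ :+ θ)) :* N :* (θ :* (θ :* N) :- con 2ℚ)
          :+ N :* (con 1ℚ :- con 3ℚ :* θ :+ θ))) refl θ N)
      where
      0≤g = p≤q⇒0≤q-p 3θ≤1

  regular⇒good : ∀ G → irregularity π Ψ G ≤ D * D → TriangleWalkStaysInClusterMore Ψ G
  regular⇒good G Z≤D² u = regular⇒stays 2≤k Ψ hp hq balanced 0<θ 3θ≤q gap 1≤θθN u G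
    T-small
    (p*p≤q*q⇒∣p∣≤q 0<D (≤-trans (≤-by (W′ * W′ + ∑U²) (0≤p+q (0≤p*p W′) 0≤∑U²)
      (+-assoc (W * W) (W′ * W′) ∑U²)) at-u))
    (p*p≤q*q⇒∣p∣≤q 0<D (≤-trans (≤-by (W * W + ∑U²) (0≤p+q (0≤p*p W) 0≤∑U²)
      (solve 3 (λ x y z → (x :+ y) :+ z := y :+ (x :+ z)) refl (W * W) (W′ * W′) ∑U²)) at-u))
    where
    open ≤-Reasoning
    W = pathDeviation π (χ ∘ inCluster Ψ (Ψ u)) u G
    W′ = pathDeviation π (χ ∘ not ∘ inCluster Ψ (Ψ u)) u G
    U : Fin k → ℚ
    U c = offDiagonal π (χ ∘ inCluster Ψ c) u G
    ∑U² = ∑ℚ λ c → U c * U c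

    0≤∑U² : 0ℚ ≤ ∑U²
    0≤∑U² = ∑-nonNeg λ c → 0≤p*p (U c)

    at-u : (W * W + W′ * W′) + ∑U² ≤ D * D
    at-u = ≤-trans (term≤∑ (0≤irregularityAt π Ψ G) u) Z≤D²

    U-small : ∀ c → ∣ U c ∣ ≤ D
    U-small c = p*p≤q*q⇒∣p∣≤q 0<D (≤-trans (term≤∑ (λ c → 0≤p*p (U c)) c)
      (≤-trans (≤-by (W * W + W′ * W′) (0≤p+q (0≤p*p W) (0≤p*p W′)) (+-comm (W * W + W′ * W′) ∑U²)) at-u))

    T-small : ∀ c → ∣ degreeDeviation π (χ ∘ inCluster Ψ c) u G ∣ ≤ θ * N
    T-small c = p*p≤q*q⇒∣p∣≤q 0<θN (begin
      T * T                            ≤⟨ degreeDeviation² hπ (inCluster Ψ c) u G ⟩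
      U c + ∑ℚ (χ ∘ inCluster Ψ c)     ≡⟨ cong (U c +_) (clusterSize Ψ hp hq balanced c) ⟩
      U c + N                          ≤⟨ +-monoˡ-≤ N (≤-trans (p≤∣p∣ (U c)) (U-small c)) ⟩
      D + N                            ≤⟨ D+N≤θN² ⟩
      θ * N * (θ * N)                  ∎)
      where T = degreeDeviation π (χ ∘ inCluster Ψ c) u G

  -- A graph that is not good has irregularity above D².
  D²≤ : ∀ G → D * D ≤ D * D * good Ψ G + irregularity π Ψ G
  D²≤ G = byCases (triangleWalkStaysInClusterMore? Ψ G) (regular⇒good G)
    where
    Z = irregularity π Ψ G
    byCases : ∀ {P : Set} (P? : Dec P) → (Z ≤ D * D → P) → D * D ≤ D * D * χ (does P?) + Z
    byCases (yes _) _ = ≤-by Z (∑-nonNeg (0≤irregularityAt π Ψ G)) (cong (_+ Z) (*-identityʳ (D * D)))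
    byCases (no ¬p) h = subst (D * D ≤_)
      (solve 2 (λ x z → z := x :* con 0ℚ :+ z) refl (D * D) Z) (<⇒≤ (≰⇒> (¬p ∘ h)))

  markov : let B = ι m * (ι m * 2ℚ) in
    D * D ≤ D * D * E π (good Ψ) + ι m * ((B + B) + ι k * B)
  markov = begin
    D * D
      ≡⟨ E-const π (D * D) ⟨
    E π (λ _ → D * D)
      ≤⟨ E-mono hπ D²≤ ⟩
    E π (λ G → D * D * good Ψ G + irregularity π Ψ G)
      ≡⟨ trans (E-+ π (λ G → D * D * good Ψ G) (irregularity π Ψ)) (cong (_+ E π (irregularity π Ψ)) (E-*ˡ π (D * D) (good Ψ))) ⟩
    D * D * E π (good Ψ) + E π (irregularity π Ψ)
      ≤⟨ +-monoʳ-≤ (D * D * E π (good Ψ)) (E-irregularity Ψ hp hq) ⟩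
    D * D * E π (good Ψ) + _ ∎
    where open ≤-Reasoning

p≤ι : ∀ p → ∃[ n ] p ≤ ι n
p≤ι p@(mkℚ num d-1 _) = ℤ.∣ num ∣ , toℚᵘ-cancel-≤
  (ℚᵘ.≤-respʳ-≃ (ℚᵘ.≃-sym (toℚᵘ-ι ℤ.∣ num ∣)) (ℚᵘ.*≤* (bound num)))
  where
  bound : ∀ i → i ℤ.* ℤ.+ 1 ℤ.≤ ℤ.+ ℤ.∣ i ∣ ℤ.* ℤ.+ suc d-1
  bound (ℤ.+ a)    = subst₂ ℤ._≤_ (ℤ.pos-* a 1) (ℤ.pos-* a (suc d-1))
    (ℤ.+≤+ (ℕ.*-monoʳ-≤ a (ℕ.s≤s ℕ.z≤n)))
  bound ℤ.-[1+ a ] = ℤ.-≤+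

ι-mono : ∀ {m n} → m ℕ.≤ n → ι m ≤ ι n
ι-mono {n = n} ℕ.z≤n = 0≤ι n
ι-mono (ℕ.s≤s m≤n)   = +-monoʳ-≤ 1ℚ (ι-mono m≤n)

archimedean : ∀ x C → 0ℚ < x → ∃[ N ] (∀ n → N ℕ.≤ n → C ≤ x * ι n)
archimedean x C 0<x = proj₁ above , λ n N≤n → begin
  C                 ≡⟨ *-identityʳ C ⟨
  C * 1ℚ            ≡⟨ cong (C *_) (*-inverseˡ x) ⟨
  C * (1/ x * x)    ≡⟨ solve 3 (λ c y x → c :* (y :* x) := x :* (c :* y)) refl C (1/ x) x ⟩
  x * (C * 1/ x)    ≤⟨ ≤-* x (<⇒≤ 0<x) (≤-trans (proj₂ above) (ι-mono N≤n)) ⟩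
  x * ι n           ∎
  where
  open ≤-Reasoning
  instance x≢0 = pos⇒nonZero x {{positive 0<x}}
  above = p≤ι (C * 1/ x)

-- The bound is uniform in p and q, subject to q and p - q being bounded below
-- in terms of θ.  This uniformity lets rational approximations of real p and q
-- be treated simultaneously.
concentration : ∀ {k} → 2 ℕ.≤ k → ∀ {θ} → 0ℚ < θ → ∀ {ε} → 0ℚ < ε →
  ∃[ N ] (∀ n → N ℕ.≤ n → (Ψ : Fin (k ℕ.* n) → Fin k) → Balanced n Ψ →
    ∀ {p q} → IsProb p → IsProb q → 3ℚ * θ ≤ q → q + 4ℚ * θ ≤ p →
    1ℚ - ε ≤ E (plantedℚ Ψ p q) (good Ψ))
concentration {k} 2≤k {θ} 0<θ {ε} 0<ε = proj₁ large₁ ℕ.⊔ proj₁ large₂ , λ n N≤n Ψ balanced {p} {q} hp hq 3θ≤q gap →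
  let N  = ι n
      m  = k ℕ.* n
      B  = ι m * (ι m * 2ℚ)
      D  = θ * (θ * N) * (θ * N)
      P  = E (plantedℚ Ψ p q) (good Ψ)
      large  : 2ℚ ≤ θ * (θ * N)
      large  = subst (2ℚ ≤_) (*-assoc θ θ N) (proj₂ large₁ n (ℕ.m⊔n≤o⇒m≤o (proj₁ large₁) (proj₁ large₂) N≤n))
      C≤ : C ≤ x * N
      C≤ = proj₂ large₂ n (ℕ.m⊔n≤o⇒n≤o (proj₁ large₁) (proj₁ large₂) N≤n)
      0<N : 0ℚ < N
      0<N = *-cancelˡ-<-nonNeg (θ * θ) {{nonNegative (0≤p*p θ)}}
        (subst (_< θ * θ * N) (sym (*-zeroʳ (θ * θ)))
          (<-≤-trans (positive⁻¹ 2ℚ) (subst (2ℚ ≤_) (sym (*-assoc θ θ N)) large)))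
      0<D² : 0ℚ < D * D
      0<D² = let 0<D = 0<p*q (0<p*q 0<θ (0<p*q 0<θ 0<N)) (0<p*q 0<θ 0<N) in 0<p*q 0<D 0<D
      E≤ : ι m * ((B + B) + κ * B) ≤ D * D * ε
      E≤ = ≤-by ((N * N * N) * (x * N - C))
        (0≤p*q (0≤p*q (0≤p*p N) (<⇒≤ 0<N)) (p≤q⇒0≤q-p C≤))
        (trans
          (solve 4 (λ θ N ε κ →
            let two = con 2ℚ ; m = κ :* N ; b = m :* (m :* two) ; d = θ :* (θ :* N) :* (θ :* N)
                c = κ :* (κ :* (κ :* two)) :* (two :+ κ) ; y = θ :* θ :* θ :* (θ :* θ :* θ) :* ε in
            d :* d :* ε := m :* ((b :+ b) :+ κ :* b) :+ (N :* N :* N) :* (y :* N :- c)) refl θ N ε κ)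
          (cong (λ z → z * ((z * (z * 2ℚ) + z * (z * 2ℚ)) + κ * (z * (z * 2ℚ)))
                     + (N * N * N) * (x * N - C)) (sym (ι-* k n))))
  in *-cancelˡ-≤-pos (D * D) {{positive 0<D²}}
    (≤-by ((D * D * P + ι m * ((B + B) + κ * B) - D * D) + (D * D * ε - ι m * ((B + B) + κ * B)))
      (0≤p+q (p≤q⇒0≤q-p (markov 2≤k Ψ hp hq balanced 0<θ 3θ≤q gap large)) (p≤q⇒0≤q-p E≤))
      (solve 4 (λ d P z ε → d :* P := d :* (con 1ℚ :- ε) :+ ((d :* P :+ z :- d) :+ (d :* ε :- z))) refl
        (D * D) P (ι m * ((B + B) + κ * B)) ε))
  where
  κ = ι k
  -- C * N³ is the bound on the expected irregularity, and x * N⁴ equals ε * D².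
  C = κ * (κ * (κ * 2ℚ)) * (2ℚ + κ)
  x = θ * θ * θ * (θ * θ * θ) * ε
  large₁ = archimedean (θ * θ) 2ℚ (0<p*q 0<θ 0<θ)
  large₂ = archimedean x C (0<p*q (0<p*q (0<p*q (0<p*q 0<θ 0<θ) 0<θ) (0<p*q (0<p*q 0<θ 0<θ) 0<θ)) 0<ε)

-- Passage to real edge probabilities

-- Sums over lists.
∑ˡ : {X : Set} → (X → ℚ) → List X → ℚ
∑ˡ f []       = 0ℚ
∑ˡ f (x ∷ xs) = f x + ∑ˡ f xs

-- Products over lists.
∏ˡ : {X : Set} → (X → ℚ) → List X → ℚ
∏ˡ f []       = 1ℚ
∏ˡ f (x ∷ xs) = f x * ∏ˡ f xs

module _ {X : Set} where

  ∑ˡ-cong : ∀ {f g : X → ℚ} → (∀ x → f x ≡ g x) → ∀ xs → ∑ˡ f xs ≡ ∑ˡ g xs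
  ∑ˡ-cong f≡g []       = refl
  ∑ˡ-cong f≡g (x ∷ xs) = cong₂ _+_ (f≡g x) (∑ˡ-cong f≡g xs)

  ∑ˡ-*ˡ : ∀ c (f : X → ℚ) xs → ∑ˡ (λ x → c * f x) xs ≡ c * ∑ˡ f xs
  ∑ˡ-*ˡ c f []       = sym (*-zeroʳ c)
  ∑ˡ-*ˡ c f (x ∷ xs) = trans (cong (c * f x +_) (∑ˡ-*ˡ c f xs)) (sym (*-distribˡ-+ c (f x) (∑ˡ f xs)))

  ∑ˡ-++ : ∀ (f : X → ℚ) xs ys → ∑ˡ f (xs ++ ys) ≡ ∑ˡ f xs + ∑ˡ f ys
  ∑ˡ-++ f []       ys = sym (+-identityˡ (∑ˡ f ys))
  ∑ˡ-++ f (x ∷ xs) ys = trans (cong (f x +_) (∑ˡ-++ f xs ys)) (sym (+-assoc (f x) (∑ˡ f xs) (∑ˡ f ys)))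

  ∏ˡ-++ : ∀ (f : X → ℚ) xs ys → ∏ˡ f (xs ++ ys) ≡ ∏ˡ f xs * ∏ˡ f ys
  ∏ˡ-++ f []       ys = sym (*-identityˡ (∏ˡ f ys))
  ∏ˡ-++ f (x ∷ xs) ys = trans (cong (f x *_) (∏ˡ-++ f xs ys)) (sym (*-assoc (f x) (∏ˡ f xs) (∏ˡ f ys)))

  seq-product : ∀ (f : X → ℝ) i xs → seq (productᴿ (map f xs)) i ≡ ∏ˡ (λ x → seq (f x) i) xs
  seq-product f i []       = refl
  seq-product f i (x ∷ xs) = cong (seq (f x) i *_) (seq-product f i xs)

  seq-sum-filter : ∀ (f : X → ℝ) {P : Pred X 0ℓ} (P? : Decidable P) i xs →
    seq (sumᴿ (map f (filter P? xs))) i ≡ ∑ˡ (λ x → seq (f x) i * χ (does (P? x))) xs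
  seq-sum-filter f P? i []       = refl
  seq-sum-filter f P? i (x ∷ xs) with does (P? x)
  ... | true  = cong₂ _+_ (sym (*-identityʳ (seq (f x) i))) (seq-sum-filter f P? i xs)
  ... | false = trans (seq-sum-filter f P? i xs)
    (trans (sym (+-identityˡ _)) (cong (_+ ∑ˡ (λ x → seq (f x) i * χ (does (P? x))) xs) (sym (*-zeroʳ (seq (f x) i)))))

∑ˡ-map : ∀ {X Y : Set} (f : Y → ℚ) (g : X → Y) xs → ∑ˡ f (map g xs) ≡ ∑ˡ (f ∘ g) xs
∑ˡ-map f g []       = refl
∑ˡ-map f g (x ∷ xs) = cong (f (g x) +_) (∑ˡ-map f g xs)

∏ˡ-map : ∀ {X Y : Set} (f : Y → ℚ) (g : X → Y) xs → ∏ˡ f (map g xs) ≡ ∏ˡ (f ∘ g) xs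
∏ˡ-map f g []       = refl
∏ˡ-map f g (x ∷ xs) = cong (f (g x) *_) (∏ˡ-map f g xs)

∑ˡ-cartesianProduct : {X Y Z : Set} (f : Z → ℚ) (g : X → Y → Z) → ∀ xs ys →
  ∑ˡ f (cartesianProductWith g xs ys) ≡ ∑ˡ (λ x → ∑ˡ (λ y → f (g x y)) ys) xs
∑ˡ-cartesianProduct f g []       ys = refl
∑ˡ-cartesianProduct f g (x ∷ xs) ys = trans (∑ˡ-++ f (map (g x) ys) (cartesianProductWith g xs ys))
  (cong₂ _+_ (∑ˡ-map f (g x) ys) (∑ˡ-cartesianProduct f g xs ys))

-- The probability that an edge of probability x is present or absent, as b says.
edgeWeight : ℚ → Bool → ℚ
edgeWeight x b = if b then x else 1ℚ - x

-- The probability of a row under independent entries.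
rowWeight : ∀ {m} → (Fin m → ℚ) → Vec Bool m → ℚ
rowWeight ρ []      = 1ℚ
rowWeight ρ (b ∷ r) = edgeWeight (ρ zero) b * rowWeight (ρ ∘ suc) r

-- The probability of a graph, as a product along its rows.
graphWeight : ∀ {m} → (Fin m → Fin m → ℚ) → Graph m → ℚ
graphWeight π []      = 1ℚ
graphWeight π (r ∷ G) = rowWeight (π zero ∘ suc) r * graphWeight (λ u v → π (suc u) (suc v)) G

∏ˡ-tabulate : ∀ {m} {X : Set} (f : X → ℚ) (g : Fin m → X) (ρ : Fin m → ℚ) (r : Vec Bool m) →
  (∀ v → f (g v) ≡ edgeWeight (ρ v) (lookup r v)) → ∏ˡ f (tabulate g) ≡ rowWeight ρ r
∏ˡ-tabulate f g ρ []      h = refl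
∏ˡ-tabulate f g ρ (b ∷ r) h = cong₂ _*_ (h zero) (∏ˡ-tabulate f (g ∘ suc) (ρ ∘ suc) r (h ∘ suc))

∏ˡ-pairs : ∀ {m} (π : Fin m → Fin m → ℚ) (G : Graph m) →
  ∏ˡ (λ (u , v) → edgeWeight (π u v) (adjacent G u v)) (pairs m) ≡ graphWeight π G
∏ˡ-pairs π []      = refl
∏ˡ-pairs {suc m} π (r ∷ G) = trans
  (∏ˡ-++ f (map (λ v → zero , suc v) (allFin m)) _)
  (cong₂ _*_
    (trans (∏ˡ-map f (λ v → zero , suc v) (allFin m))
      (∏ˡ-tabulate (λ v → f (zero , suc v)) (λ v → v) (π zero ∘ suc) r (λ _ → refl)))
    (trans (∏ˡ-map f _ (pairs m)) (∏ˡ-pairs (λ u v → π (suc u) (suc v)) G)))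
  where
  f : Fin (suc m) × Fin (suc m) → ℚ
  f (u , v) = edgeWeight (π u v) (adjacent (r ∷ G) u v)

∏ˡ-cong : ∀ {X : Set} {f g : X → ℚ} → (∀ x → f x ≡ g x) → ∀ xs → ∏ˡ f xs ≡ ∏ˡ g xs
∏ˡ-cong f≡g []       = refl
∏ˡ-cong f≡g (x ∷ xs) = cong₂ _*_ (f≡g x) (∏ˡ-cong f≡g xs)

seq-weight : ∀ {m} (π : Fin m → Fin m → ℝ) G i →
  seq (weight π G) i ≡ graphWeight (λ u v → seq (π u v) i) G
seq-weight {m} π G i = trans
  (seq-product (λ (u , v) → if adjacent G u v then π u v else 1ᴿ -ᴿ π u v) i (pairs m))
  (trans (∏ˡ-cong (λ (u , v) → byCases (π u v) (adjacent G u v)) (pairs m))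
    (∏ˡ-pairs (λ u v → seq (π u v) i) G))
  where
  byCases : ∀ x b → seq (if b then x else 1ᴿ -ᴿ x) i ≡ edgeWeight (seq x i) b
  byCases x true  = refl
  byCases x false = refl

Erow-∑ : ∀ {m} (ρ : Fin m → ℚ) F → ∑ˡ (λ r → rowWeight ρ r * F r) (allRows m) ≡ Erow ρ F
Erow-∑ {zero}  ρ F = trans (+-identityʳ (1ℚ * F [])) (*-identityˡ (F []))
Erow-∑ {suc m} ρ F = trans
  (∑ˡ-cartesianProduct (λ r → rowWeight ρ r * F r) _∷_ (true ∷ false ∷ []) (allRows m))
  (cong₂ _+_ (step true) (trans (+-identityʳ _) (step false)))
  where
  step : ∀ b → ∑ˡ (λ r → edgeWeight (ρ zero) b * rowWeight (ρ ∘ suc) r * F (b ∷ r)) (allRows m)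
    ≡ edgeWeight (ρ zero) b * Erow (ρ ∘ suc) (λ r → F (b ∷ r))
  step b = trans
    (∑ˡ-cong (λ r → *-assoc (edgeWeight (ρ zero) b) (rowWeight (ρ ∘ suc) r) (F (b ∷ r))) (allRows m))
    (trans (∑ˡ-*ˡ (edgeWeight (ρ zero) b) (λ r → rowWeight (ρ ∘ suc) r * F (b ∷ r)) (allRows m))
      (cong (edgeWeight (ρ zero) b *_) (Erow-∑ (ρ ∘ suc) (λ r → F (b ∷ r)))))

E-∑ˡ : ∀ {m} (π : Fin m → Fin m → ℚ) F → ∑ˡ (λ G → graphWeight π G * F G) (allGraphs m) ≡ E π F
E-∑ˡ {zero}  π F = trans (+-identityʳ (1ℚ * F [])) (*-identityˡ (F []))
E-∑ˡ {suc m} π F = trans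
  (∑ˡ-cartesianProduct (λ G → graphWeight π G * F G) _∷_ (allRows m) (allGraphs m))
  (trans (∑ˡ-cong row (allRows m)) (Erow-∑ (π zero ∘ suc) (λ r → E π′ (λ G → F (r ∷ G)))))
  where
  π′ = λ u v → π (suc u) (suc v)
  row : ∀ r → ∑ˡ (λ G → rowWeight (π zero ∘ suc) r * graphWeight π′ G * F (r ∷ G)) (allGraphs m)
    ≡ rowWeight (π zero ∘ suc) r * E π′ (λ G → F (r ∷ G))
  row r = trans
    (∑ˡ-cong (λ G → *-assoc (rowWeight (π zero ∘ suc) r) (graphWeight π′ G) (F (r ∷ G))) (allGraphs m))
    (trans (∑ˡ-*ˡ (rowWeight (π zero ∘ suc) r) (λ G → graphWeight π′ G * F (r ∷ G)) (allGraphs m))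
      (cong (rowWeight (π zero ∘ suc) r *_) (E-∑ˡ π′ (λ G → F (r ∷ G)))))

-- The rational approximations of the real probability are expectations under
-- the approximations of the edge probabilities.
seq-Pr : ∀ {m} (π : Fin m → Fin m → ℝ) {P : Pred (Graph m) 0ℓ} (P? : Decidable P) i →
  seq (Pr π P?) i ≡ E (λ u v → seq (π u v) i) (λ G → χ (does (P? G)))
seq-Pr {m} π P? i = trans (seq-sum-filter (weight π) P? i (allGraphs m))
  (trans (∑ˡ-cong (λ G → cong (_* χ (does (P? G))) (seq-weight π G i)) (allGraphs m))
    (E-∑ˡ (λ u v → seq (π u v) i) (λ G → χ (does (P? G)))))

Erow-isProb : ∀ {m} {ρ : Fin m → ℚ} → (∀ v → IsProb (ρ v)) →
  ∀ {F} → (∀ r → IsProb (F r)) → IsProb (Erow ρ F)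
Erow-isProb {ρ = ρ} hρ {F} hF =
  subst (_≤ Erow ρ F) (Erow-const ρ 0ℚ) (Erow-mono hρ (proj₁ ∘ hF)) ,
  subst (Erow ρ F ≤_) (Erow-const ρ 1ℚ) (Erow-mono hρ (proj₂ ∘ hF))

E-isProb : ∀ {m} {π : Fin m → Fin m → ℚ} → (∀ u v → IsProb (π u v)) →
  ∀ {F} → (∀ G → IsProb (F G)) → IsProb (E π F)
E-isProb {π = π} hπ {F} hF =
  subst (_≤ E π F) (E-const π 0ℚ) (E-mono hπ (proj₁ ∘ hF)) ,
  subst (E π F ≤_) (E-const π 1ℚ) (E-mono hπ (proj₂ ∘ hF))

∣prob∣≤1 : ∀ {x} → IsProb x → ∣ x ∣ ≤ 1ℚ
∣prob∣≤1 (0≤x , x≤1) = subst (_≤ 1ℚ) (sym (0≤p⇒∣p∣≡p 0≤x)) x≤1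

∣p*q∣≤ : ∀ {p q a b} → 0ℚ ≤ b → ∣ p ∣ ≤ a → ∣ q ∣ ≤ b → ∣ p * q ∣ ≤ a * b
∣p*q∣≤ {p} {q} {a} {b} 0≤b p≤a q≤b = subst (_≤ a * b) (sym (∣p*q∣≡∣p∣*∣q∣ p q))
  (*-mono-≤-nonNeg (0≤∣p∣ p) 0≤b p≤a q≤b)

∣p+q∣≤ : ∀ {p q a b} → ∣ p ∣ ≤ a → ∣ q ∣ ≤ b → ∣ p + q ∣ ≤ a + b
∣p+q∣≤ {p} {q} p≤a q≤b = ≤-trans (∣p+q∣≤∣p∣+∣q∣ p q) (+-mono-≤ p≤a q≤b)

-- The expectation over one edge depends continuously on its probability and on
-- the two conditional expectations.
mixture-close : ∀ {p p′ a a′ b b′ d η} → IsProb p′ → IsProb a′ → IsProb b′ → η ≤ 1ℚ → 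
  ∣ p - p′ ∣ ≤ η → ∣ a - a′ ∣ ≤ d → ∣ b - b′ ∣ ≤ d →
  ∣ (p * a + (1ℚ - p) * b) - (p′ * a′ + (1ℚ - p′) * b′) ∣ ≤ 4ℚ * d + 2ℚ * η
mixture-close {p} {p′} {a} {a′} {b} {b′} {d} {η} hp′ ha′ hb′ η≤1 p-close a-close b-close =
  subst₂ _≤_ (cong ∣_∣ (solve 6 (λ p p′ a a′ b b′ →
      (p :* (a :- a′) :+ (con 1ℚ :- p) :* (b :- b′)) :+ ((p :- p′) :* a′ :+ (p :- p′) :* (:- b′))
      := (p :* a :+ (con 1ℚ :- p) :* b) :- (p′ :* a′ :+ (con 1ℚ :- p′) :* b′)) refl p p′ a a′ b b′))
    (solve 2 (λ d η → (con 2ℚ :* d :+ con 2ℚ :* d) :+ (η :* con 1ℚ :+ η :* con 1ℚ) := con 4ℚ :* d :+ con 2ℚ :* η) refl d η)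
    (∣p+q∣≤ (∣p+q∣≤ (∣p*q∣≤ 0≤d ∣p∣≤2 a-close) (∣p*q∣≤ 0≤d ∣1-p∣≤2 b-close))
            (∣p+q∣≤ (∣p*q∣≤ (nonNegative⁻¹ 1ℚ) p-close (∣prob∣≤1 ha′))
                    (∣p*q∣≤ (nonNegative⁻¹ 1ℚ) p-close (subst (_≤ 1ℚ) (sym (∣-p∣≡∣p∣ b′)) (∣prob∣≤1 hb′)))))
  where
  0≤d : 0ℚ ≤ d
  0≤d = ≤-trans (0≤∣p∣ (a - a′)) a-close
  ∣p∣≤2 : ∣ p ∣ ≤ 2ℚ
  ∣p∣≤2 = subst (λ x → ∣ x ∣ ≤ 2ℚ) (solve 2 (λ p p′ → (p :- p′) :+ p′ := p) refl p p′)
    (∣p+q∣≤ (≤-trans p-close η≤1) (∣prob∣≤1 hp′))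
  ∣1-p∣≤2 : ∣ 1ℚ - p ∣ ≤ 2ℚ
  ∣1-p∣≤2 = subst (λ x → ∣ x ∣ ≤ 2ℚ) (solve 2 (λ p p′ → :- (p :- p′) :+ (con 1ℚ :- p′) := con 1ℚ :- p) refl p p′)
    (∣p+q∣≤ (≤-trans (≤-reflexive (∣-p∣≡∣p∣ (p - p′))) (≤-trans p-close η≤1))
      (∣prob∣≤1 (p≤q⇒0≤q-p (proj₂ hp′) ,
        ≤-by p′ (proj₁ hp′) (solve 1 (λ p → con 1ℚ := (con 1ℚ :- p) :+ p) refl p′))))

-- The recursion is that of mixture-close; the constant is only required to
-- be finite for each m.
rowLipschitz : ℕ → ℚ
rowLipschitz zero    = 1ℚ
rowLipschitz (suc m) = 4ℚ * rowLipschitz m + 2ℚ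

Erow-close : ∀ {m} {ρ ρ′ : Fin m → ℚ} {F F′ d η} → (∀ v → IsProb (ρ′ v)) → (∀ r → IsProb (F′ r)) →
  0ℚ ≤ d → 0ℚ ≤ η → η ≤ 1ℚ → (∀ v → ∣ ρ v - ρ′ v ∣ ≤ η) → (∀ r → ∣ F r - F′ r ∣ ≤ d) →
  ∣ Erow ρ F - Erow ρ′ F′ ∣ ≤ rowLipschitz m * (d + η)
Erow-close {zero} {d = d} {η} _ _ _ 0≤η _ _ F-close = ≤-trans (F-close [])
  (≤-by η 0≤η (*-identityˡ (d + η)))
Erow-close {suc m} {ρ} {ρ′} {F} {F′} {d} {η} hρ′ hF′ 0≤d 0≤η η≤1 ρ-close F-close = ≤-trans
  (mixture-close {p = ρ zero} {a = Erow (ρ ∘ suc) (λ r → F (true ∷ r))} {b = Erow (ρ ∘ suc) (λ r → F (false ∷ r))}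
    (hρ′ zero)
    (Erow-isProb {ρ = ρ′ ∘ suc} (hρ′ ∘ suc) (λ r → hF′ (true ∷ r)))
    (Erow-isProb {ρ = ρ′ ∘ suc} (hρ′ ∘ suc) (λ r → hF′ (false ∷ r)))
    η≤1 (ρ-close zero) (tail true) (tail false))
  (≤-by (2ℚ * d) (0≤p*q (nonNegative⁻¹ 2ℚ) 0≤d)
    (solve 3 (λ l d η → (con 4ℚ :* l :+ con 2ℚ) :* (d :+ η) := con 4ℚ :* (l :* (d :+ η)) :+ con 2ℚ :* η :+ con 2ℚ :* d)
      refl (rowLipschitz m) d η))
  where
  tail : ∀ b → ∣ Erow (ρ ∘ suc) (λ r → F (b ∷ r)) - Erow (ρ′ ∘ suc) (λ r → F′ (b ∷ r)) ∣
    ≤ rowLipschitz m * (d + η)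
  tail b = Erow-close (hρ′ ∘ suc) (λ r → hF′ (b ∷ r)) 0≤d 0≤η η≤1 (ρ-close ∘ suc) (λ r → F-close (b ∷ r))

-- A Lipschitz constant, near the unit cube, of the expectation as a function of
-- the edge probabilities.
lipschitz : ℕ → ℚ
lipschitz zero    = 0ℚ
lipschitz (suc m) = rowLipschitz m * (lipschitz m + 1ℚ)

0≤rowLipschitz : ∀ m → 0ℚ ≤ rowLipschitz m
0≤rowLipschitz zero    = nonNegative⁻¹ 1ℚ
0≤rowLipschitz (suc m) = 0≤p+q (0≤p*q (nonNegative⁻¹ 4ℚ) (0≤rowLipschitz m)) (nonNegative⁻¹ 2ℚ)

0≤lipschitz : ∀ m → 0ℚ ≤ lipschitz m
0≤lipschitz zero    = ≤-refl
0≤lipschitz (suc m) = 0≤p*q (0≤rowLipschitz m) (0≤p+q (0≤lipschitz m) (nonNegative⁻¹ 1ℚ))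

-- Only π′ has to consist of probabilities; π may lie slightly outside the
-- interval from 0 to 1, as approximations of a probability can.
E-close : ∀ {m} {π π′ : Fin m → Fin m → ℚ} {F η} → (∀ u v → IsProb (π′ u v)) →
  (∀ G → IsProb (F G)) → 0ℚ ≤ η → η ≤ 1ℚ → (∀ u v → ∣ π u v - π′ u v ∣ ≤ η) →
  ∣ E π F - E π′ F ∣ ≤ lipschitz m * η
E-close {zero} {F = F} {η} _ _ _ _ _ = ≤-reflexive
  (trans (cong ∣_∣ (+-inverseʳ (F []))) (sym (*-zeroˡ η)))
E-close {suc m} {π} {π′} {F} {η} hπ′ hF 0≤η η≤1 π-close = ≤-trans
  (Erow-close {F = λ r → E (λ u v → π (suc u) (suc v)) (λ G → F (r ∷ G))}
    {F′ = λ r → E (λ u v → π′ (suc u) (suc v)) (λ G → F (r ∷ G))}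
    (λ v → hπ′ zero (suc v))
    (λ r → E-isProb (λ u v → hπ′ (suc u) (suc v)) (λ G → hF (r ∷ G)))
    (0≤p*q (0≤lipschitz m) 0≤η) 0≤η η≤1 (λ v → π-close zero (suc v))
    (λ r → E-close (λ u v → hπ′ (suc u) (suc v)) (λ G → hF (r ∷ G)) 0≤η η≤1 (λ u v → π-close (suc u) (suc v))))
  (≤-reflexive (solve 3 (λ r l η → r :* (l :* η :+ η) := r :* (l :+ con 1ℚ) :* η) refl (rowLipschitz m) (lipschitz m) η))

⅛ : ℚ
⅛ = ½ * (½ * ½)

⅛-fraction : ∀ {x y} → x ≤ y → ⅛ * x + (3ℚ * (⅛ * x) + 4ℚ * (⅛ * x)) ≤ y
⅛-fraction {x} = ≤-trans (≤-reflexive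
  (solve 1 (λ x → con ⅛ :* x :+ (con 3ℚ :* (con ⅛ :* x) :+ con 4ℚ :* (con ⅛ :* x)) := x) refl x))

0<⊓ : ∀ {x y} → 0ℚ < x → 0ℚ < y → 0ℚ < x ⊓ y
0<⊓ {x} {y} 0<x 0<y with ≤-total x y
... | inj₁ x≤y = subst (0ℚ <_) (sym (p≤q⇒p⊓q≡p x≤y)) 0<x
... | inj₂ y≤x = subst (0ℚ <_) (sym (p≥q⇒p⊓q≡q y≤x)) 0<y

smallMultiple : ∀ C {x} → 0ℚ ≤ C → 0ℚ < x → ∃[ y ] 0ℚ < y × C * y ≤ x
smallMultiple C {x} 0≤C 0<x = 1/ D * x , 0<p*q (positive⁻¹ (1/ D) {{1/pos⇒pos D {{positive 0<D}}}}) 0<x ,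
  ≤-by (1/ D * x) (<⇒≤ (0<p*q (positive⁻¹ (1/ D) {{1/pos⇒pos D {{positive 0<D}}}}) 0<x))
    (trans (sym (trans (cong (_* x) (*-inverseʳ D)) (*-identityˡ x)))
      (solve 3 (λ C i x → (C :+ con 1ℚ) :* i :* x := C :* (i :* x) :+ i :* x) refl C (1/ D) x))
  where
  D = C + 1ℚ
  0<D : 0ℚ < D
  0<D = +-mono-≤-< 0≤C (positive⁻¹ 1ℚ)
  instance D≢0 = pos⇒nonZero D {{positive 0<D}}

clamp-close : ∀ {x η} → 0ℚ ≤ η → x ≤ 1ℚ + η → ∣ x - x ⊓ 1ℚ ∣ ≤ η
clamp-close {x} {η} 0≤η x≤1+η with ≤-total x 1ℚ
... | inj₁ x≤1 = subst (λ z → ∣ x - z ∣ ≤ η) (sym (p≤q⇒p⊓q≡p x≤1))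
  (subst (λ z → ∣ z ∣ ≤ η) (sym (+-inverseʳ x)) 0≤η)
... | inj₂ 1≤x = subst (λ z → ∣ x - z ∣ ≤ η) (sym (p≥q⇒p⊓q≡q 1≤x))
  (subst (_≤ η) (sym (0≤p⇒∣p∣≡p (p≤q⇒0≤q-p 1≤x)))
    (≤-by (1ℚ + η - x) (p≤q⇒0≤q-p x≤1+η)
      (solve 2 (λ x η → η := (x :- con 1ℚ) :+ (con 1ℚ :+ η :- x)) refl x η)))

lemma1 : (k : ℕ) → 2 ℕ.≤ k → (p q : ℝ) → 0ᴿ <ᴿ q → q <ᴿ p → p ≤ᴿ 1ᴿ →
    (ε : ℝ) → 0ᴿ <ᴿ ε →
    ∃[ N ] ((n : ℕ) → N ℕ.≤ n →
    (Ψ : Fin (k ℕ.* n) → Fin k) → Balanced n Ψ →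
    1ᴿ -ᴿ ε ≤ᴿ Pr (plantedPartition Ψ p q) (triangleWalkStaysInClusterMore? Ψ))
lemma1 k 2≤k p q (q₀ , 0<q₀ , I₁ , q≥) (d , 0<d , I₂ , p≥) p≤1 ε (ε₀ , 0<ε₀ , I₃ , ε≥) =
  proj₁ conc , conclusion
  where
  x = q₀ ⊓ d
  -- Both q and p - q are eventually at least 8 θ, which leaves room for the
  -- clamping of p below.
  θ = ⅛ * x
  0<x = 0<⊓ 0<q₀ 0<d
  0<θ : 0ℚ < θ
  0<θ = 0<p*q (positive⁻¹ ⅛) 0<x
  0≤θ = <⇒≤ 0<θ
  conc = concentration 2≤k 0<θ 0<ε₀

  conclusion : (n : ℕ) → proj₁ conc ℕ.≤ n → (Ψ : Fin (k ℕ.* n) → Fin k) → Balanced n Ψ →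
    1ᴿ -ᴿ ε ≤ᴿ Pr (plantedPartition Ψ p q) (triangleWalkStaysInClusterMore? Ψ)
  conclusion n N≤n Ψ balanced ε′ 0<ε′ = I , bound
    where
    L = lipschitz (k ℕ.* n)
    small = smallMultiple L (0≤lipschitz (k ℕ.* n)) 0<ε′
    -- The smallness of η makes E-close applicable, keeps q + 4 θ below 1, and
    -- makes the clamping error L * η at most ε′.
    η = (θ ⊓ 1ℚ) ⊓ proj₁ small
    0<η : 0ℚ < η
    0<η = 0<⊓ (0<⊓ 0<θ (positive⁻¹ 1ℚ)) (proj₁ (proj₂ small))
    0≤η = <⇒≤ 0<η
    η≤θ : η ≤ θ
    η≤θ = ≤-trans (p⊓q≤p (θ ⊓ 1ℚ) (proj₁ small)) (p⊓q≤p θ 1ℚ)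
    η≤1 : η ≤ 1ℚ
    η≤1 = ≤-trans (p⊓q≤p (θ ⊓ 1ℚ) (proj₁ small)) (p⊓q≤q θ 1ℚ)
    Lη≤ε′ : L * η ≤ ε′
    Lη≤ε′ = ≤-trans (≤-* L (0≤lipschitz (k ℕ.* n)) (p⊓q≤q (θ ⊓ 1ℚ) (proj₁ small))) (proj₂ (proj₂ small))

    I₄ = proj₁ (p≤1 η 0<η)
    I = (I₁ ℕ.⊔ I₂) ℕ.⊔ (I₃ ℕ.⊔ I₄)

    bound : ∀ i → I ℕ.≤ i → seq (1ᴿ -ᴿ ε) i ≤
      seq (Pr (plantedPartition Ψ p q) (triangleWalkStaysInClusterMore? Ψ)) i + ε′
    bound i I≤i = begin
      1ℚ - seq ε i
        ≤⟨ +-monoʳ-≤ 1ℚ (neg-antimono-≤ (subst (_≤ seq ε i) (+-identityˡ ε₀) (ε≥ i I₃≤i))) ⟩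
      1ℚ - ε₀
        ≤⟨ proj₂ conc n N≤n Ψ balanced hp′ hq 3θ≤q gap ⟩
      E π′ (good Ψ)
        ≤⟨ ≤-by (L * η - (E π′ (good Ψ) - E π (good Ψ))) (p≤q⇒0≤q-p E-close-below)
             (solve 3 (λ x y z → y :+ z := x :+ (z :- (x :- y))) refl (E π′ (good Ψ)) (E π (good Ψ)) (L * η)) ⟩
      E π (good Ψ) + L * η
        ≤⟨ +-monoʳ-≤ (E π (good Ψ)) Lη≤ε′ ⟩
      E π (good Ψ) + ε′
        ≡⟨ cong (_+ ε′) (seq-Pr (plantedPartition Ψ p q) (triangleWalkStaysInClusterMore? Ψ) i) ⟨
      seq (Pr (plantedPartition Ψ p q) (triangleWalkStaysInClusterMore? Ψ)) i + ε′ ∎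
      where
      open ≤-Reasoning
      I₁₂≤i = ℕ.m⊔n≤o⇒m≤o (I₁ ℕ.⊔ I₂) (I₃ ℕ.⊔ I₄) I≤i
      I₃₄≤i = ℕ.m⊔n≤o⇒n≤o (I₁ ℕ.⊔ I₂) (I₃ ℕ.⊔ I₄) I≤i
      I₃≤i = ℕ.m⊔n≤o⇒m≤o I₃ I₄ I₃₄≤i

      pᵢ = seq p i
      qᵢ = seq q i
      -- The approximation pᵢ is at most 1 + η but may exceed 1.
      p′ = pᵢ ⊓ 1ℚ
      π = λ u v → seq (plantedPartition Ψ p q u v) i
      π′ = plantedℚ Ψ p′ qᵢ

      q₀≤q : q₀ ≤ qᵢ
      q₀≤q = subst (_≤ qᵢ) (+-identityˡ q₀) (q≥ i (ℕ.m⊔n≤o⇒m≤o I₁ I₂ I₁₂≤i))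

      q+d≤p : qᵢ + d ≤ pᵢ
      q+d≤p = p≥ i (ℕ.m⊔n≤o⇒n≤o I₁ I₂ I₁₂≤i)

      p≤1+η : pᵢ ≤ 1ℚ + η
      p≤1+η = proj₂ (p≤1 η 0<η) i (ℕ.m⊔n≤o⇒n≤o I₃ I₄ I₃₄≤i)

      8θ≤q : θ + (3ℚ * θ + 4ℚ * θ) ≤ qᵢ
      8θ≤q = ≤-trans (⅛-fraction (p⊓q≤p q₀ d)) q₀≤q

      8θ≤d : θ + (3ℚ * θ + 4ℚ * θ) ≤ d
      8θ≤d = ⅛-fraction (p⊓q≤q q₀ d)

      3θ≤q : 3ℚ * θ ≤ qᵢ
      3θ≤q = ≤-trans (≤-by (θ + 4ℚ * θ) (0≤p+q 0≤θ (0≤p*q (nonNegative⁻¹ 4ℚ) 0≤θ))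
        (solve 1 (λ θ → θ :+ (con 3ℚ :* θ :+ con 4ℚ :* θ) := con 3ℚ :* θ :+ (θ :+ con 4ℚ :* θ)) refl θ)) 8θ≤q

      q+8θ≤p : qᵢ + (θ + (3ℚ * θ + 4ℚ * θ)) ≤ pᵢ
      q+8θ≤p = ≤-trans (+-monoʳ-≤ qᵢ 8θ≤d) q+d≤p

      gap : qᵢ + 4ℚ * θ ≤ p′
      gap = ⊓-glb
        (≤-trans (≤-by (4ℚ * θ) (0≤p*q (nonNegative⁻¹ 4ℚ) 0≤θ)
          (solve 2 (λ q θ → q :+ (θ :+ (con 3ℚ :* θ :+ con 4ℚ :* θ))
            := (q :+ con 4ℚ :* θ) :+ con 4ℚ :* θ) refl qᵢ θ)) q+8θ≤p)
        (≤-by ((1ℚ + η - (qᵢ + (θ + (3ℚ * θ + 4ℚ * θ)))) + ((θ - η) + 3ℚ * θ))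
          (0≤p+q (p≤q⇒0≤q-p (≤-trans q+8θ≤p p≤1+η))
            (0≤p+q (p≤q⇒0≤q-p η≤θ) (0≤p*q (nonNegative⁻¹ 3ℚ) 0≤θ)))
          (solve 3 (λ q θ η → con 1ℚ := (q :+ con 4ℚ :* θ)
            :+ ((con 1ℚ :+ η :- (q :+ (θ :+ (con 3ℚ :* θ :+ con 4ℚ :* θ)))) :+ ((θ :- η) :+ con 3ℚ :* θ)))
            refl qᵢ θ η))

      q≤p′ : qᵢ ≤ p′
      q≤p′ = ≤-trans (≤-by (4ℚ * θ) (0≤p*q (nonNegative⁻¹ 4ℚ) 0≤θ) refl) gap

      0≤q : 0ℚ ≤ qᵢ
      0≤q = ≤-trans (<⇒≤ 0<q₀) q₀≤q

      hq : IsProb qᵢ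
      hq = 0≤q , ≤-trans q≤p′ (p⊓q≤q pᵢ 1ℚ)

      hp′ : IsProb p′
      hp′ = ≤-trans 0≤q q≤p′ , p⊓q≤q pᵢ 1ℚ

      π-close : ∀ u v → ∣ π u v - π′ u v ∣ ≤ η
      π-close u v with does (Ψ u Fin.≟ Ψ v)
      ... | true  = clamp-close 0≤η p≤1+η
      ... | false = subst (λ z → ∣ z ∣ ≤ η) (sym (+-inverseʳ qᵢ)) 0≤η

      E-close-below : E π′ (good Ψ) - E π (good Ψ) ≤ L * η
      E-close-below = subst (_≤ L * η)
        (solve 2 (λ x y → :- (x :- y) := y :- x) refl (E π (good Ψ)) (E π′ (good Ψ)))
        (≤-trans (-p≤∣p∣ (E π (good Ψ) - E π′ (good Ψ)))
          (E-close {π = π} {F = good Ψ} (plantedℚ-isProb Ψ hp′ hq)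
            (λ G → 0≤χ (does (triangleWalkStaysInClusterMore? Ψ G)) , χ≤1 (does (triangleWalkStaysInClusterMore? Ψ G)))
            0≤η η≤1 π-close))
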